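{- For any integer $N\geq 8$, the graph $\mathcal{F}_N$ has a Hamilton cycle.
   Context: Let $N\geq 3$ and label the points of a convex $N$-gon by $1,\ldots,N$ in counterclockwise order. The associahedron $\mathcal{G}_N$ is the graph whose nodes are all triangulations of the convex $N$-gon, with an edge between two triangulations if they differ in a flip; a flip removes an edge (diagonal) shared by two triangles and replaces it by the other diagonal of the resulting quadrilateral. Color point $i$ red if $i$ is odd and blue if $i$ is even. A triangulation is colorful if no triangle has all three of its points of the same color. $\mathcal{F}_N$ denotes the subgraph of $\mathcal{G}_N$ induced by all colorful triangulations. -}

module Defs where

open import Data.Nat using (ℕ; zero; suc; _+_; _∸_; _<_; _≤_)
open import Data.Nat.Properties using (_≟_)
open import Data.Bool using (Bool; true; false)
open import Data.Fin using (Fin; toℕ)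
open import Data.Vec using (Vec; lookup)
open import Data.List using (List; _∷_; []; _++_; length)
open import Data.List.Relation.Unary.All using (All)
open import Data.List.Relation.Unary.Linked using (Linked)
open import Data.List.Relation.Unary.Unique.Propositional using (Unique)
open import Data.List.Membership.Propositional using (_∈_)
open import Data.Product using (Σ; _×_; ∃; ∃-syntax; _,_)
open import Data.Sum using (_⊎_)
open import Relation.Binary.PropositionalEquality using (_≡_; _≢_)
open import Relation.Nullary using (¬_)

-- Points of the convex N-gon are Fin N, 0-based: point i : Fin N is the
-- paper's point (toℕ i + 1), in counterclockwise order.

-- A candidate set of diagonals: an N×N Boolean matrix; entry (i,j) = true
-- means the segment ij (with i < j) is in the set.
DiagMatrix : ℕ → Set
DiagMatrix N = Vec (Vec Bool N) N

_[_,_] : {N : ℕ} → DiagMatrix N → Fin N → Fin N → Bool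
M [ i , j ] = lookup (lookup M i) j

BoundarySide : {N : ℕ} → Fin N → Fin N → Set
BoundarySide {N} i j = (suc (toℕ i) ≡ toℕ j) ⊎ ((toℕ i ≡ 0) × (suc (toℕ j) ≡ N))

IsDiagonal : {N : ℕ} → Fin N → Fin N → Set
IsDiagonal i j = (toℕ i < toℕ j) × ¬ BoundarySide i j

Cross : {N : ℕ} → Fin N → Fin N → Fin N → Fin N → Set
Cross a b c d =
  ((toℕ a < toℕ c) × (toℕ c < toℕ b) × (toℕ b < toℕ d)) ⊎
  ((toℕ c < toℕ a) × (toℕ a < toℕ d) × (toℕ d < toℕ b))

-- A triangulation: a maximal set of pairwise non-crossing diagonals
-- (stored canonically: only entries (i,j) with i<j forming a diagonal are true).
record IsTriangulation {N : ℕ} (M : DiagMatrix N) : Set where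
  field
    onlyDiagonals : ∀ i j → M [ i , j ] ≡ true → IsDiagonal i j
    nonCrossing   : ∀ a b c d → M [ a , b ] ≡ true → M [ c , d ] ≡ true → ¬ Cross a b c d
    maximal       : ∀ a b → IsDiagonal a b → M [ a , b ] ≡ false →
                    ∃[ c ] ∃[ d ] (M [ c , d ] ≡ true × Cross a b c d)

Edge : {N : ℕ} → DiagMatrix N → Fin N → Fin N → Set
Edge M i j = (toℕ i < toℕ j) × (BoundarySide i j ⊎ (M [ i , j ] ≡ true))

IsTriangle : {N : ℕ} → DiagMatrix N → Fin N → Fin N → Fin N → Set
IsTriangle M a b c = Edge M a b × Edge M b c × Edge M a c

-- colour: paper's point k is red iff k odd; point i : Fin N is paper's point
-- toℕ i + 1, so it is red iff toℕ i is even.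
parity : ℕ → Bool
parity zero = false
parity (suc zero) = true
parity (suc (suc n)) = parity n

colour : {N : ℕ} → Fin N → Bool
colour i = parity (toℕ i)

Monochromatic : {N : ℕ} → Fin N → Fin N → Fin N → Set
Monochromatic a b c = (colour a ≡ colour b) × (colour b ≡ colour c)

Colorful : {N : ℕ} → DiagMatrix N → Set
Colorful M = ∀ a b c → IsTriangle M a b c → ¬ Monochromatic a b c

-- The flip in the quadrilateral a<b<c<d (whose four sides are edges of M and
-- whose diagonal ac is in M, so abc and acd are triangles of M):
-- M' is M with diagonal ac removed and replaced by bd.
FlipIn : {N : ℕ} → DiagMatrix N → DiagMatrix N → Fin N → Fin N → Fin N → Fin N → Set
FlipIn M M' a b c d =
  (toℕ a < toℕ b) × (toℕ b < toℕ c) × (toℕ c < toℕ d) ×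
  Edge M a b × Edge M b c × Edge M c d × Edge M a d ×
  (M [ a , c ] ≡ true) ×
  (M' [ a , c ] ≡ false) × (M' [ b , d ] ≡ true) ×
  (∀ i j → ¬ (((i ≡ a) × (j ≡ c)) ⊎ ((i ≡ b) × (j ≡ d))) → M' [ i , j ] ≡ M [ i , j ])

DifferByFlip : {N : ℕ} → DiagMatrix N → DiagMatrix N → Set
DifferByFlip M M' = ∃[ a ] ∃[ b ] ∃[ c ] ∃[ d ] (FlipIn M M' a b c d ⊎ FlipIn M' M a b c d)

IsNodeF : {N : ℕ} → DiagMatrix N → Set
IsNodeF M = IsTriangulation M × Colorful M

HamiltonCycle : {A : Set} → (V : A → Set) → (Adj : A → A → Set) → Set
HamiltonCycle {A} V Adj =
  Σ A λ x → Σ (List A) λ xs →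
    (3 ≤ length (x ∷ xs)) ×
    Unique (x ∷ xs) ×
    All V (x ∷ xs) ×
    (∀ v → V v → v ∈ (x ∷ xs)) ×
    Linked Adj ((x ∷ xs) ++ (x ∷ []))

-- F_N: subgraph of the associahedron induced by colorful triangulations
F-HasHamiltonCycle : ℕ → Set
F-HasHamiltonCycle N = HamiltonCycle {DiagMatrix N} IsNodeF DifferByFlip

{-# OPTIONS --safe #-}
-- For N = 2n + 2, the bichromatic diagonals of a colorful triangulation cut the polygon into n
-- quadrilaterals, and each quadrilateral is cut by one of its two monochromatic diagonals. So
-- the colorful triangulations are the ternary trees with n nodes labelled by bits, those of a
-- fixed shape form an n-dimensional cube, and flipping a bichromatic diagonal is a rotation at
-- two nodes with prescribed labels that keeps all other labels. A Hamilton cycle is built by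
-- induction on n: two copies of the cycle for n - 1, one of them reversed, cover the trees whose
-- root has only a left subtree. Every other cube is inserted into the cycle: it has a Hamilton
-- path between the ends of any of its edges, and a rotation at the root matches such an edge
-- with an edge of the cube of another shape, in which more of the tree lies to the left. The
-- edges reserved for different insertions lie in disjoint subcubes, so no insertion destroys an
-- edge that is needed later. For N = 2n + 3 the triangulations are pairs of ternary trees, and
-- the same method extends the cycle for N - 1.
module Submission where

open import Defs
open import Data.Bool using (Bool; true; false; not; if_then_else_)
import Data.Bool as Bool
open import Data.Bool.Properties using (¬-not; not-involutive; not-¬)
open import Data.Empty using (⊥-elim)
open import Data.Fin using (Fin; zero; suc; toℕ; fromℕ<; punchIn; punchOut)
import Data.Fin.Properties as Fin
open import Data.Fin.Properties using (toℕ-fromℕ<; toℕ<n; toℕ-injective; fromℕ<-injective; punchIn-punchOut)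
open import Data.List using (List; []; _∷_; _++_; map; reverse; length; filter; cartesianProductWith; cartesianProduct)
open import Data.List.Properties using (unfold-reverse; length-map)
open import Data.List.Membership.Propositional using (_∈_; _∉_)
open import Data.List.Membership.Propositional.Properties
  using (∈-map⁺; ∈-map⁻; ∈-++⁺ˡ; ∈-++⁺ʳ; ∈-++⁻; ∈-filter⁺; ∈-filter⁻; ∈-cartesianProductWith⁺; ∈-cartesianProduct⁺)
open import Data.List.Relation.Binary.Permutation.Propositional using (_↭_; ↭-sym; ↭-trans; prep; ↭⇒↭ₛ)
open import Data.List.Relation.Binary.Permutation.Propositional.Properties using (shift; ∈-resp-↭; ↭-reverse)
import Data.List.Relation.Binary.Permutation.Setoid.Properties as PermutationSetoid
open import Data.List.Relation.Binary.Subset.Propositional using (_⊆_)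
open import Data.List.Relation.Unary.All using (All; []; _∷_; all?)
import Data.List.Relation.Unary.All as All
import Data.List.Relation.Unary.AllPairs as AllPairs
open import Data.List.Relation.Unary.Any using (here; there; any?)
open import Data.List.Relation.Unary.Linked using (Linked; [-]; _∷_)
open import Data.List.Relation.Unary.Unique.Propositional using (Unique)
open import Data.List.Relation.Unary.Unique.Propositional.Properties using (++⁺; map⁺)
open import Data.Maybe using (Maybe; just; nothing; from-just; _<∣>_; zipWith) renaming (map to mapᴹ)
open import Data.Nat using (ℕ; zero; suc; _+_; _*_; _∸_; _≤_; _<_; s≤s; z≤n; _≤?_; _<?_)
import Data.Nat as ℕ
open import Data.Nat.Properties
open import Data.Nat.Tactic.RingSolver using (solve-∀)
open import Data.Product using (∃; _×_; _,_; proj₁; proj₂; ∃-syntax)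
open import Data.Product.Properties using (≡-dec)
open import Data.Sum using (_⊎_; inj₁; inj₂; [_,_]′; swap)
open import Data.Unit using (⊤; tt)
open import Data.Vec using (Vec; []; _∷_; lookup; tabulate; take; drop; updateAt; insertAt; removeAt; replicate; _[_]≔_)
  renaming (_++_ to _++ᵛ_)
open import Data.Vec.Properties
  using (lookup∘tabulate; tabulate∘lookup; tabulate-cong; take++drop≡id; insertAt-lookup; removeAt-insertAt; insertAt-removeAt;
         lookup∘update; lookup∘update′; lookup∘updateAt′)
open import Function using (_∘_)
open import Relation.Binary using (tri<; tri≈; tri>)
open import Relation.Binary.Definitions using (DecidableEquality; Symmetric)
open import Relation.Binary.PropositionalEquality hiding ([_])
open import Relation.Nullary using (¬_; Dec; yes; no; does; contradiction)
open import Relation.Nullary.Decidable using (_×-dec_; _⊎-dec_; ¬?; dec-true; dec-false; map′; from-yes; dec⇒maybe)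

-- The difficulty is that an inserted path cannot choose its ends: the edge it replaces dictates
-- them, and still the path must contain an edge of every subcube reserved for later insertions. The
-- Hamilton paths of the cubes therefore zigzag in one fixed direction and use all edges in this
-- direction except possibly the one at their start. A reserved subcube keeps another such edge as
-- soon as there is a free coordinate besides the direction and the prescribed labels. For trees
-- this means two labels, one free coordinate and one direction, so cubes of dimension four, and the
-- induction has to be fed with a cycle for three nodes. Which subcubes are reserved follows from
-- the rotations: they act on trees with root label `false` and left label `true`, or with root
-- label `true` and middle label `true`. Insertions never break edges between trees whose relevant
-- child is labelled `false` or empty; these edges are passed on to the next size.

either : ∀ (b c : Bool) → c ≡ b ⊎ c ≡ not b
either false false = inj₁ refl
either false true  = inj₂ refl
either true  false = inj₂ refl
either true  true  = inj₁ refl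

not-≡ : ∀ b → not b ≢ b
not-≡ false ()
not-≡ true ()

-- Triangulations as binary trees

data Bin : Set where
  leaf : Bin
  bin  : Bin → Bin → Bin

width : Bin → ℕ
width leaf      = 1
width (bin l r) = width l + width r

0<width : ∀ t → 0 < width t
0<width leaf      = s≤s z≤n
0<width (bin l r) = ≤-trans (0<width l) (m≤m+n _ _)

-- A binary tree t spans the polygon on the points p, …, p + width t;
-- Mem t p i j says that ij is a side or a diagonal of this triangulated polygon.
data Mem : Bin → ℕ → ℕ → ℕ → Set where
  root : ∀ {t p j} → p + width t ≡ j → Mem t p p j
  inˡ  : ∀ {l r p i j} → Mem l p i j → Mem (bin l r) p i j
  inʳ  : ∀ {l r p i j} → Mem r (p + width l) i j → Mem (bin l r) p i j

p<end : ∀ t p → p < p + width t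
p<end t p = m<m+n p (0<width t)

Mem-shift : ∀ {t p q i j} → p ≡ q → Mem t p i j → Mem t q i j
Mem-shift refl e = e

Mem-lower : ∀ {t p i j} → Mem t p i j → p ≤ i
Mem-lower (root _) = ≤-refl
Mem-lower (inˡ e)  = Mem-lower e
Mem-lower (inʳ e)  = ≤-trans (m≤m+n _ _) (Mem-lower e)

Mem-upper : ∀ {t p i j} → Mem t p i j → j ≤ p + width t
Mem-upper (root refl) = ≤-refl
Mem-upper {bin l r} {p} (inˡ e) = ≤-trans (Mem-upper e) (+-monoʳ-≤ p (m≤m+n _ _))
Mem-upper {bin l r} {p} (inʳ e) = ≤-trans (Mem-upper e) (≤-reflexive (+-assoc p _ _))

Mem-< : ∀ {t p i j} → Mem t p i j → i < j
Mem-< {t} (root refl) = p<end t _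
Mem-< (inˡ e) = Mem-< e
Mem-< (inʳ e) = Mem-< e

Mem? : ∀ t p i j → Dec (Mem t p i j)
Mem? leaf p i j = map′ (λ { (refl , e) → root e }) (λ { (root e) → refl , e }) ((p ≟ i) ×-dec (p + 1 ≟ j))
Mem? (bin l r) p i j =
  map′ (λ { (inj₁ (refl , e)) → root e ; (inj₂ (inj₁ e)) → inˡ e ; (inj₂ (inj₂ e)) → inʳ e })
       (λ { (root e) → inj₁ (refl , e) ; (inˡ e) → inj₂ (inj₁ e) ; (inʳ e) → inj₂ (inj₂ e) })
       (((p ≟ i) ×-dec (p + width (bin l r) ≟ j)) ⊎-dec (Mem? l p i j ⊎-dec Mem? r (p + width l) i j))

Mem-restrictˡ : ∀ {l r p i j} → Mem (bin l r) p i j → j ≤ p + width l → Mem l p i j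
Mem-restrictˡ {l} {r} {p} (root refl) j≤ =
  contradiction (+-cancelˡ-≤ p _ _ j≤) (<⇒≱ (m<m+n (width l) (0<width r)))
Mem-restrictˡ (inˡ e) _  = e
Mem-restrictˡ (inʳ e) j≤ = contradiction (≤-trans j≤ (Mem-lower e)) (<⇒≱ (Mem-< e))

Mem-restrictʳ : ∀ {l r p i j} → Mem (bin l r) p i j → p + width l ≤ i → Mem r (p + width l) i j
Mem-restrictʳ {l} (root refl) ≤i = contradiction ≤i (<⇒≱ (p<end l _))
Mem-restrictʳ (inˡ e) ≤i = contradiction (≤-trans (Mem-upper e) ≤i) (<⇒≱ (Mem-< e))
Mem-restrictʳ (inʳ e) _  = e

Crossℕ : ℕ → ℕ → ℕ → ℕ → Set
Crossℕ a b c d = ((a < c) × (c < b) × (b < d)) ⊎ ((c < a) × (a < d) × (d < b))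

Mem-noncrossing : ∀ {t p a b c d} → Mem t p a b → Mem t p c d → ¬ (a < c × c < b × b < d)
Mem-noncrossing e f (a<c , c<b , b<d) with e
... | root refl = <⇒≱ b<d (Mem-upper f)
Mem-noncrossing e f (a<c , c<b , b<d) | inˡ e′ with f
... | root _ = <⇒≱ a<c (Mem-lower e′)
... | inˡ f′ = Mem-noncrossing e′ f′ (a<c , c<b , b<d)
... | inʳ f′ = <⇒≱ c<b (≤-trans (Mem-upper e′) (Mem-lower f′))
Mem-noncrossing e f (a<c , c<b , b<d) | inʳ e′ with f
... | root _ = <⇒≱ a<c (≤-trans (m≤m+n _ _) (Mem-lower e′))
... | inˡ f′ = <⇒≱ a<c (≤-trans (<⇒≤ (Mem-< f′)) (≤-trans (Mem-upper f′) (Mem-lower e′)))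
... | inʳ f′ = Mem-noncrossing e′ f′ (a<c , c<b , b<d)

Mem-¬Cross : ∀ {t p a b c d} → Mem t p a b → Mem t p c d → ¬ Crossℕ a b c d
Mem-¬Cross e f (inj₁ x) = Mem-noncrossing e f x
Mem-¬Cross e f (inj₂ x) = Mem-noncrossing f e x

-- If `a` and `b` lie on different sides of the apex, then `ab` is crossed by the segment from `p`
-- to the apex, unless `a` is `p`; in that case it is crossed by the segment from the apex to the
-- end, unless `ab` is the root segment.
Mem-maximal : ∀ t p a b → p ≤ a → a < b → b ≤ p + width t →
              Mem t p a b ⊎ ∃[ c ] ∃[ d ] (Mem t p c d × Crossℕ a b c d)
Mem-maximal leaf p a b p≤a a<b b≤ =
  inj₁ (subst (λ x → Mem leaf p x b) p≡a (root (≤-antisym (≤-trans (≤-reflexive (+-comm p 1)) (≤-trans (s≤s p≤a) a<b)) b≤)))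
  where
  p≡a : p ≡ a
  p≡a = ≤-antisym p≤a (≤-pred (≤-trans a<b (≤-trans b≤ (≤-reflexive (+-comm p 1)))))
Mem-maximal (bin l r) p a b p≤a a<b b≤ with b ≤? p + width l | p + width l ≤? a
... | yes b≤m | _ = [ inj₁ ∘ inˡ , (λ { (c , d , e , x) → inj₂ (c , d , inˡ e , x) }) ]′ (Mem-maximal l p a b p≤a a<b b≤m)
... | no _ | yes m≤a = [ inj₁ ∘ inʳ , (λ { (c , d , e , x) → inj₂ (c , d , inʳ e , x) }) ]′
                         (Mem-maximal r _ a b m≤a a<b (≤-trans b≤ (≤-reflexive (sym (+-assoc p _ _)))))
... | no b≰m | no m≰a with p ≟ a
...   | no p≢a = inj₂ (p , p + width l , inˡ (root refl) , inj₂ (≤∧≢⇒< p≤a p≢a , ≰⇒> m≰a , ≰⇒> b≰m))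
...   | yes refl with p + width (bin l r) ≟ b
...     | yes eq = inj₁ (root eq)
...     | no neq = inj₂ (_ , _ , inʳ (root (+-assoc p _ _)) , inj₁ (≰⇒> m≰a , ≰⇒> b≰m , ≤∧≢⇒< b≤ (neq ∘ sym)))

-- The apexes at the root agree, since otherwise the segment below the apex in one tree would cross
-- the segment above the apex in the other. Below a common apex the inclusion restricts to both
-- subtrees.
Mem-injective : ∀ t t′ p → width t ≡ width t′ → (∀ {i j} → Mem t p i j → Mem t′ p i j) → t ≡ t′
Mem-injective leaf leaf p w sub = refl
Mem-injective leaf (bin l r) p w sub =
  contradiction (≤-trans (+-mono-≤ (0<width l) (0<width r)) (≤-reflexive (sym w))) λ { (s≤s ()) }
Mem-injective (bin l r) leaf p w sub =
  contradiction (≤-trans (+-mono-≤ (0<width l) (0<width r)) (≤-reflexive w)) λ { (s≤s ()) }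
Mem-injective (bin l r) (bin l′ r′) p w sub = cong₂ bin l≡ r≡
  where
  open ≤-Reasoning
  end : p + width l + width r ≡ p + width l′ + width r′
  end = trans (+-assoc p _ _) (trans (cong (p +_) w) (sym (+-assoc p _ _)))
  m≡ : p + width l ≡ p + width l′
  m≡ with <-cmp (p + width l) (p + width l′)
  ... | tri≈ _ eq _ = eq
  ... | tri< m<m′ _ _ = ⊥-elim (Mem-noncrossing (inˡ {r = r′} (root refl)) (sub (inʳ {l} (root refl)))
          (p<end l p , m<m′ , ≤-trans (p<end r′ _) (≤-reflexive (sym end))))
  ... | tri> _ _ m′<m = ⊥-elim (Mem-noncrossing (sub (inˡ {r = r} (root refl))) (inʳ {l′} (root refl))
          (p<end l′ p , m′<m , ≤-trans (p<end r _) (≤-reflexive end)))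
  wl≡ : width l ≡ width l′
  wl≡ = +-cancelˡ-≡ p _ _ m≡
  l≡ : l ≡ l′
  l≡ = Mem-injective l l′ p wl≡ λ e → Mem-restrictˡ (sub (inˡ e)) (≤-trans (Mem-upper e) (≤-reflexive m≡))
  r≡ : r ≡ r′
  r≡ = Mem-injective r r′ (p + width l) (+-cancelˡ-≡ (p + width l) _ _ (trans end (cong (_+ width r′) (sym m≡))))
         λ {i} {j} e → subst (λ q → Mem r′ q i j) (sym m≡)
           (Mem-restrictʳ (sub (inʳ e)) (≤-trans (≤-reflexive (sym m≡)) (Mem-lower e)))

-- Tree rotation is the flip: `x`, `y`, `z` span three sides of a quadrilateral whose fourth side is
-- the root segment; `bin x y` is the diagonal from the first to the third corner, `bin y z` the one
-- from the second to the fourth.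
data Rot : Bin → Bin → Set where
  here : ∀ {x y z} → Rot (bin (bin x y) z) (bin x (bin y z))
  onˡ  : ∀ {l l′ r} → Rot l l′ → Rot (bin l r) (bin l′ r)
  onʳ  : ∀ {l r r′} → Rot r r′ → Rot (bin l r) (bin l r′)

Rot-width : ∀ {t t′} → Rot t t′ → width t ≡ width t′
Rot-width (here {x} {y} {z}) = +-assoc (width x) (width y) (width z)
Rot-width (onˡ {r = r} ρ) = cong (_+ width r) (Rot-width ρ)
Rot-width (onʳ {l} ρ) = cong (width l +_) (Rot-width ρ)

record RotQuad (t t′ : Bin) (p a b c d : ℕ) : Set where
  field
    a<b : a < b
    b<c : b < c
    c<d : c < d
    ab  : Mem t p a b
    bc  : Mem t p b c
    cd  : Mem t p c d
    ad  : Mem t p a d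
    ac  : Mem t p a c
    bd  : Mem t′ p b d
    to  : ∀ {i j} → ¬ (i ≡ a × j ≡ c) → Mem t p i j → Mem t′ p i j
    from : ∀ {i j} → ¬ (i ≡ b × j ≡ d) → Mem t′ p i j → Mem t p i j

rotQuad : ∀ {t t′} p → Rot t t′ → ∃[ a ] ∃[ b ] ∃[ c ] ∃[ d ] RotQuad t t′ p a b c d
rotQuad p (here {x} {y} {z}) = p , p + width x , p + (width x + width y) , p + (width x + width y + width z) , record
  { a<b = p<end x p
  ; b<c = +-monoʳ-< p (m<m+n _ (0<width y))
  ; c<d = +-monoʳ-< p (m<m+n _ (0<width z))
  ; ab = inˡ (inˡ (root refl))
  ; bc = inˡ (inʳ (root (+-assoc p _ _)))
  ; cd = inʳ (root (+-assoc p _ _))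
  ; ad = root refl
  ; ac = inˡ (root refl)
  ; bd = inʳ (root (trans (+-assoc p _ _) (cong (p +_) (sym (+-assoc (width x) _ _)))))
  ; to = λ where
      ¬ac (root e) → root (trans (cong (p +_) (sym (Rot-width (here {x} {y} {z})))) e)
      ¬ac (inˡ (root e)) → contradiction (refl , sym e) ¬ac
      ¬ac (inˡ (inˡ e)) → inˡ e
      ¬ac (inˡ (inʳ e)) → inʳ (inˡ e)
      ¬ac (inʳ e) → inʳ (inʳ (Mem-shift (sym (+-assoc p _ _)) e))
  ; from = λ where
      ¬bd (root e) → root (trans (cong (p +_) (Rot-width (here {x} {y} {z}))) e)
      ¬bd (inˡ e) → inˡ (inˡ e)
      ¬bd (inʳ (root e)) → contradiction (refl , trans (sym e) (trans (+-assoc p _ _) (cong (p +_) (sym (+-assoc (width x) _ _))))) ¬bd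
      ¬bd (inʳ (inˡ e)) → inˡ (inʳ e)
      ¬bd (inʳ (inʳ e)) → inʳ (Mem-shift (+-assoc p _ _) e)
  }
rotQuad p (onˡ {l} {l′} {r} ρ) with rotQuad p ρ
... | a , b , c , d , Q = a , b , c , d , record
  { a<b = a<b ; b<c = b<c ; c<d = c<d
  ; ab = inˡ ab ; bc = inˡ bc ; cd = inˡ cd ; ad = inˡ ad ; ac = inˡ ac ; bd = inˡ bd
  ; to = λ where
      n (root e) → root (trans (cong (λ w → p + (w + width r)) (sym (Rot-width ρ))) e)
      n (inˡ e) → inˡ (to n e)
      n (inʳ e) → inʳ (subst (λ w → Mem r (p + w) _ _) (Rot-width ρ) e)
  ; from = λ where
      n (root e) → root (trans (cong (λ w → p + (w + width r)) (Rot-width ρ)) e)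
      n (inˡ e) → inˡ (from n e)
      n (inʳ e) → inʳ (subst (λ w → Mem r (p + w) _ _) (sym (Rot-width ρ)) e)
  }
  where open RotQuad Q
rotQuad p (onʳ {l} {r} {r′} ρ) with rotQuad (p + width l) ρ
... | a , b , c , d , Q = a , b , c , d , record
  { a<b = a<b ; b<c = b<c ; c<d = c<d
  ; ab = inʳ ab ; bc = inʳ bc ; cd = inʳ cd ; ad = inʳ ad ; ac = inʳ ac ; bd = inʳ bd
  ; to = λ where
      n (root e) → root (trans (cong (λ w → p + (width l + w)) (sym (Rot-width ρ))) e)
      n (inˡ e) → inˡ e
      n (inʳ e) → inʳ (to n e)
  ; from = λ where
      n (root e) → root (trans (cong (λ w → p + (width l + w)) (Rot-width ρ)) e)
      n (inˡ e) → inˡ e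
      n (inʳ e) → inʳ (from n e)
  }
  where open RotQuad Q

-- Diagonal matrices of binary trees

BoundarySide? : ∀ {N} (i j : Fin N) → Dec (BoundarySide i j)
BoundarySide? {N} i j = (suc (toℕ i) ≟ toℕ j) ⊎-dec ((toℕ i ≟ 0) ×-dec (suc (toℕ j) ≟ N))

-- The leaves and the root of a tree are sides of the polygon, which the matrix does not store.
IsDiag : ∀ {N} → Bin → Fin N → Fin N → Set
IsDiag t i j = Mem t 0 (toℕ i) (toℕ j) × ¬ BoundarySide i j

IsDiag? : ∀ {N} t (i j : Fin N) → Dec (IsDiag t i j)
IsDiag? t i j = Mem? t 0 (toℕ i) (toℕ j) ×-dec ¬? (BoundarySide? i j)

enc : ∀ N → Bin → DiagMatrix N
enc N t = tabulate λ i → tabulate λ j → does (IsDiag? t i j)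

enc-entry : ∀ {N} t (i j : Fin N) → enc N t [ i , j ] ≡ does (IsDiag? t i j)
enc-entry t i j = trans (cong (λ v → lookup v j) (lookup∘tabulate _ i)) (lookup∘tabulate _ j)

does⁻ : ∀ {P : Set} (d : Dec P) → does d ≡ true → P
does⁻ (yes p) _ = p

enc⁺ : ∀ {N} {t} {i j : Fin N} → IsDiag t i j → enc N t [ i , j ] ≡ true
enc⁺ {t = t} {i} {j} d = trans (enc-entry t i j) (dec-true (IsDiag? t i j) d)

enc⁻ : ∀ {N} t {i j : Fin N} → enc N t [ i , j ] ≡ true → IsDiag t i j
enc⁻ t {i} {j} e = does⁻ (IsDiag? t i j) (trans (sym (enc-entry t i j)) e)

enc-false : ∀ {N} {t} {i j : Fin N} → ¬ IsDiag t i j → enc N t [ i , j ] ≡ false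
enc-false {t = t} {i} {j} d = trans (enc-entry t i j) (dec-false (IsDiag? t i j) d)

true≢false : ∀ {b : Bool} → b ≡ true → b ≢ false
true≢false refl ()

does-≡ : ∀ {P : Set} (d : Dec P) (b : Bool) → (P → b ≡ true) → (b ≡ true → P) → does d ≡ b
does-≡ (yes p) b f g = sym (f p)
does-≡ (no ¬p) true f g = contradiction (g refl) ¬p
does-≡ (no ¬p) false f g = refl

side-uncrossed : ∀ {N} {i j c d : Fin N} → BoundarySide i j → ¬ Cross i j c d
side-uncrossed (inj₁ e) (inj₁ (p , q , _)) = <⇒≱ (≤-trans q (≤-reflexive (sym e))) p
side-uncrossed (inj₁ e) (inj₂ (_ , p , q)) = <⇒≱ (≤-trans q (≤-reflexive (sym e))) p
side-uncrossed {d = d} (inj₂ (_ , e)) (inj₁ (_ , _ , r)) = <⇒≱ (≤-trans (toℕ<n d) (≤-reflexive (sym e))) r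
side-uncrossed (inj₂ (e , _)) (inj₂ (p , _)) = <⇒≱ p (≤-trans (≤-reflexive e) z≤n)

Cross-sym : ∀ {N} {a b c d : Fin N} → Cross a b c d → Cross c d a b
Cross-sym = swap

record Spans (N : ℕ) (t : Bin) : Set where
  constructor spans
  field width≡ : suc (width t) ≡ N

module _ {N : ℕ} {t : Bin} (S : Spans N t) where
  open Spans S

  bound : (i : Fin N) → toℕ i ≤ 0 + width t
  bound i = ≤-pred (≤-trans (toℕ<n i) (≤-reflexive (sym width≡)))

  -- By maximality of `Mem`, a segment outside the tree is crossed by one of the tree, and nothing
  -- crosses a side.
  side-Mem : ∀ {i j : Fin N} → BoundarySide i j → Mem t 0 (toℕ i) (toℕ j)
  side-Mem {i} {j} b with Mem-maximal t 0 (toℕ i) (toℕ j) z≤n i<j (bound j)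
    where
    i<j : toℕ i < toℕ j
    i<j = [ ≤-reflexive , (λ (e , e′) → ≤-trans (s≤s (≤-reflexive e)) (≤-trans (0<width t) (≤-reflexive (suc-injective (trans width≡ (sym e′)))))) ]′ b
  ... | inj₁ e = e
  ... | inj₂ (c , d , e , x) = ⊥-elim (side-uncrossed {c = fin c (<⇒≤ (Mem-< e))} {d = fin d ≤-refl} b
            (subst₂ (Crossℕ (toℕ i) (toℕ j)) (sym (toℕ-fromℕ< _)) (sym (toℕ-fromℕ< _)) x))
    where
    fin : ∀ k → k ≤ d → Fin N
    fin k k≤d = fromℕ< (≤-trans (s≤s (≤-trans k≤d (Mem-upper e))) (≤-reflexive width≡))

  Edge⇒Mem : ∀ {i j} → Edge (enc N t) i j → Mem t 0 (toℕ i) (toℕ j)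
  Edge⇒Mem (_ , inj₁ s) = side-Mem s
  Edge⇒Mem (_ , inj₂ e) = proj₁ (enc⁻ t e)

  Mem⇒Edge : ∀ {i j : Fin N} → Mem t 0 (toℕ i) (toℕ j) → Edge (enc N t) i j
  Mem⇒Edge {i} {j} e with BoundarySide? i j
  ... | yes s = Mem-< e , inj₁ s
  ... | no ¬s = Mem-< e , inj₂ (enc⁺ (e , ¬s))

  Mem-fin : ∀ {a b} → Mem t 0 a b → ∃[ i ] ∃[ j ] (toℕ {N} i ≡ a × toℕ {N} j ≡ b)
  Mem-fin {a} {b} e = fromℕ< (≤-trans (s≤s (<⇒≤ (Mem-< e))) b<N) , fromℕ< b<N , toℕ-fromℕ< _ , toℕ-fromℕ< _
    where
    b<N : b < N
    b<N = ≤-trans (s≤s (Mem-upper e)) (≤-reflexive width≡)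

  enc-triangulation : IsTriangulation (enc N t)
  enc-triangulation = record
    { onlyDiagonals = λ i j e → Mem-< (proj₁ (enc⁻ t e)) , proj₂ (enc⁻ t e)
    ; nonCrossing = λ a b c d e f → Mem-¬Cross (proj₁ (enc⁻ t e)) (proj₁ (enc⁻ t f))
    ; maximal = maximal
    }
    where
    maximal : ∀ a b → IsDiagonal a b → enc N t [ a , b ] ≡ false →
              ∃[ c ] ∃[ d ] (enc N t [ c , d ] ≡ true × Cross a b c d)
    maximal a b (a<b , ¬s) ab with Mem-maximal t 0 (toℕ a) (toℕ b) z≤n a<b (bound b)
    ... | inj₁ e = contradiction ab (true≢false (enc⁺ (e , ¬s)))
    ... | inj₂ (_ , _ , e , x) with Mem-fin e
    ...   | c , d , refl , refl = c , d , enc⁺ (e , λ s → side-uncrossed s (Cross-sym {a = a} {b} {c} {d} x)) , x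

enc-injective : ∀ {N t t′} → Spans N t → Spans N t′ → enc N t ≡ enc N t′ → t ≡ t′
enc-injective {N} {t} {t′} S S′ eq =
  Mem-injective t t′ 0 (suc-injective (trans (Spans.width≡ S) (sym (Spans.width≡ S′)))) sub
  where
  sub : ∀ {i j} → Mem t 0 i j → Mem t′ 0 i j
  sub e with Mem-fin S e
  ... | i , j , refl , refl = Edge⇒Mem S′ (subst (λ M → Edge M i j) eq (Mem⇒Edge S e))

flip-enc : ∀ {N t t′} → Spans N t → Spans N t′ → Rot t t′ →
           ∃[ a ] ∃[ b ] ∃[ c ] ∃[ d ] FlipIn (enc N t) (enc N t′) a b c d
flip-enc {N} {t} {t′} S S′ ρ with rotQuad 0 ρ
... | _ , _ , _ , _ , Q with Mem-fin S (RotQuad.ab Q) | Mem-fin S (RotQuad.cd Q)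
...   | a , b , refl , refl | c , d , refl , refl =
  a , b , c , d , a<b , b<c , c<d ,
  Mem⇒Edge S ab , Mem⇒Edge S bc , Mem⇒Edge S cd , Mem⇒Edge S ad ,
  enc⁺ (ac , λ s → side-uncrossed {c = b} {d} s ac×bd) ,
  enc-false (λ e → Mem-noncrossing (proj₁ e) bd (a<b , b<c , c<d)) ,
  enc⁺ (bd , λ s → side-uncrossed {c = a} {c} s (swap ac×bd)) ,
  unchanged
  where
  open RotQuad Q
  ac×bd : Cross a c b d
  ac×bd = inj₁ (a<b , b<c , c<d)
  unchanged : ∀ i j → ¬ (((i ≡ a) × (j ≡ c)) ⊎ ((i ≡ b) × (j ≡ d))) → enc N t′ [ i , j ] ≡ enc N t [ i , j ]
  unchanged i j n = trans (enc-entry t′ i j) (does-≡ (IsDiag? t′ i j) _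
    (λ { (e , ¬s) → enc⁺ (from (λ (p , q) → n (inj₂ (toℕ-injective p , toℕ-injective q))) e , ¬s) })
    (λ e → to (λ (p , q) → n (inj₁ (toℕ-injective p , toℕ-injective q))) (proj₁ (enc⁻ t e)) , proj₂ (enc⁻ t e)))

_⇄_ : Bin → Bin → Set
s ⇄ t = Rot s t ⊎ Rot t s

⇄-enc : ∀ {N s t} → Spans N s → Spans N t → s ⇄ t → DifferByFlip (enc N s) (enc N t)
⇄-enc S T (inj₁ ρ) = let a , b , c , d , f = flip-enc S T ρ in a , b , c , d , inj₁ f
⇄-enc S T (inj₂ ρ) = let a , b , c , d , f = flip-enc T S ρ in a , b , c , d , inj₂ f

-- Every triangulation comes from a binary tree

module _ {N : ℕ} {M : DiagMatrix N} (isT : IsTriangulation M) where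
  open IsTriangulation isT

  Edgeℕ : ℕ → ℕ → Set
  Edgeℕ a b = ∃[ i ] ∃[ j ] (toℕ i ≡ a × toℕ j ≡ b × Edge M i j)

  Edge-noncrossing : ∀ {i j c d} → Edge M i j → Edge M c d → ¬ Cross i j c d
  Edge-noncrossing (_ , inj₁ s) _ x = side-uncrossed s x
  Edge-noncrossing {i} {j} {c} {d} _ (_ , inj₁ s) x = side-uncrossed s (Cross-sym {a = i} {j} {c} {d} x)
  Edge-noncrossing (_ , inj₂ e) (_ , inj₂ f) x = nonCrossing _ _ _ _ e f x

  Edge? : ∀ i j → Dec (Edge M i j)
  Edge? i j = (toℕ i <? toℕ j) ×-dec (BoundarySide? i j ⊎-dec (M [ i , j ] Bool.≟ true))

  -- When `ij` is an edge, the triangle between its ends has as apex the last neighbour of `i`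
  -- before `j`.
  record Fan (i : Fin N) (j : ℕ) : Set where
    field
      m       : Fin N
      m<j     : toℕ m < j
      im      : Edge M i m
      largest : ∀ k → toℕ m < toℕ k → toℕ k < j → ¬ Edge M i k

  fan : ∀ i j → suc (toℕ i) < j → j ≤ N → Fan i j
  fan i zero () _
  fan i (suc j) (s≤s i<j) j<N with Edge? i (fromℕ< j<N)
  ... | yes e = record { m = fromℕ< j<N ; m<j = s≤s (≤-reflexive (toℕ-fromℕ< j<N)) ; im = e
                       ; largest = λ k m<k k<j → contradiction (≤-pred k<j) (<⇒≱ (subst (_< toℕ k) (toℕ-fromℕ< j<N) m<k)) }
  ... | no ¬e with suc (toℕ i) ≟ j
  ...   | yes eq = contradiction (≤-trans i<j (≤-reflexive (sym (toℕ-fromℕ< j<N))) , inj₁ (inj₁ (trans eq (sym (toℕ-fromℕ< j<N))))) ¬e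
  ...   | no neq = record { m = m ; m<j = m≤n⇒m≤1+n m<j ; im = im ; largest = larg }
    where
    open Fan (fan i j (≤∧≢⇒< i<j neq) (<⇒≤ j<N))
    larg : ∀ k → toℕ m < toℕ k → toℕ k < suc j → ¬ Edge M i k
    larg k m<k k<j with toℕ k ≟ j
    ... | yes eq = λ e → ¬e (subst (Edge M i) (toℕ-injective (trans eq (sym (toℕ-fromℕ< j<N)))) e)
    ... | no neq′ = largest k m<k (≤∧≢⇒< (≤-pred k<j) neq′)

  -- If `mj` were missing, maximality would give a diagonal crossing it. Such a diagonal crosses
  -- `ij` or `im`, or it starts at `i` and ends between `m` and `j`, against the choice of `m`.
  apex-edge : ∀ {i j} → Edge M i j → (F : Fan i (toℕ j)) → Edge M (Fan.m F) j
  apex-edge {i} {j} ij F with Edge? (Fan.m F) j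
  ... | yes e = e
  ... | no ¬e with maximal m j (m<j , λ s → ¬e (m<j , inj₁ s)) mj-false
    where
    open Fan F
    mj-false : M [ m , j ] ≡ false
    mj-false = ¬-not λ e → ¬e (m<j , inj₂ e)
  ...   | c , d , cd , inj₁ (m<c , c<j , j<d) =
    ⊥-elim (Edge-noncrossing ij (proj₁ (onlyDiagonals c d cd) , inj₂ cd) (inj₁ (<-trans (proj₁ (Fan.im F)) m<c , c<j , j<d)))
  ...   | c , d , cd , inj₂ (c<m , m<d , d<j) with <-cmp (toℕ c) (toℕ i)
  ...     | tri< c<i _ _ = ⊥-elim (Edge-noncrossing ij (proj₁ (onlyDiagonals c d cd) , inj₂ cd)
                              (inj₂ (c<i , <-trans (proj₁ (Fan.im F)) m<d , d<j)))
  ...     | tri≈ _ c≡i _ = ⊥-elim (Fan.largest F d m<d d<j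
                              (subst (λ k → Edge M k d) (toℕ-injective c≡i) (proj₁ (onlyDiagonals c d cd) , inj₂ cd)))
  ...     | tri> _ _ i<c = ⊥-elim (Edge-noncrossing (Fan.im F) (proj₁ (onlyDiagonals c d cd) , inj₂ cd) (inj₁ (i<c , c<m , m<d)))

  record Decoded (p q : ℕ) : Set where
    field
      tree : Bin
      end  : p + width tree ≡ q
      sub  : ∀ {a b} → Mem tree p a b → Edgeℕ a b

  -- The fuel bounds the length of the segment, which drops for both sides of the triangle at its
  -- apex.
  decode : ∀ fuel i j → Edge M i j → toℕ j ≤ fuel + toℕ i → Decoded (toℕ i) (toℕ j)
  decode zero i j (i<j , _) j≤ = contradiction j≤ (<⇒≱ i<j)
  decode (suc fuel) i j ij j≤ with suc (toℕ i) ≟ toℕ j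
  ... | yes eq = record { tree = leaf ; end = trans (+-comm _ 1) eq
                        ; sub = λ { (root refl) → i , j , refl , trans (sym eq) (+-comm 1 _) , ij } }
  ... | no neq = record { tree = bin L.tree R.tree ; end = end ; sub = sub }
    where
    F : Fan i (toℕ j)
    F = fan i (toℕ j) (≤∧≢⇒< (proj₁ ij) neq) (<⇒≤ (toℕ<n j))
    open Fan F
    module L = Decoded (decode fuel i m im (≤-pred (≤-trans m<j j≤)))
    module R = Decoded (decode fuel m j (apex-edge ij F)
                 (≤-trans j≤ (≤-trans (≤-reflexive (sym (+-suc fuel _))) (+-monoʳ-≤ fuel (proj₁ im)))))
    end : toℕ i + (width L.tree + width R.tree) ≡ toℕ j
    end = trans (sym (+-assoc (toℕ i) _ _)) (trans (cong (_+ width R.tree) L.end) R.end)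
    sub : ∀ {a b} → Mem (bin L.tree R.tree) (toℕ i) a b → Edgeℕ a b
    sub (root e) = i , j , refl , trans (sym end) e , ij
    sub (inˡ e) = L.sub e
    sub (inʳ e) = R.sub (Mem-shift L.end e)

enc-surjective : ∀ {n} {M : DiagMatrix (2 + n)} → IsTriangulation M → ∃[ t ] (Spans (2 + n) t × M ≡ enc (2 + n) t)
enc-surjective {n} {M} isT = tree , S , M≡
  where
  open IsTriangulation isT
  first last : Fin (2 + n)
  first = zero
  last = fromℕ< (n<1+n (suc n))
  last≡ : toℕ last ≡ suc n
  last≡ = toℕ-fromℕ< (n<1+n (suc n))
  open Decoded (decode isT (suc n) first last
    (≤-trans (s≤s z≤n) (≤-reflexive (sym last≡)) , inj₁ (inj₂ (refl , cong suc last≡)))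
    (≤-trans (≤-reflexive last≡) (≤-reflexive (sym (+-identityʳ _)))))
  S : Spans (2 + n) tree
  S = spans (cong suc (trans end last≡))
  Mem⇒M : ∀ {i j} → IsDiag tree i j → M [ i , j ] ≡ true
  Mem⇒M (e , ¬s) with sub e
  ... | i′ , j′ , p , q , _ , f with toℕ-injective p | toℕ-injective q
  ...   | refl | refl with f
  ...     | inj₁ s = contradiction s ¬s
  ...     | inj₂ ij = ij
  M⇒Mem : ∀ {i j} → M [ i , j ] ≡ true → IsDiag tree i j
  -- All segments of the tree are edges of `M`, so a diagonal of `M` outside the tree would cross an
  -- edge of `M`.
  M⇒Mem {i} {j} e with onlyDiagonals i j e
  ... | i<j , ¬s with Mem-maximal tree 0 (toℕ i) (toℕ j) z≤n i<j (bound S j)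
  ...   | inj₁ m = m , ¬s
  ...   | inj₂ (_ , _ , m , x) with sub m
  ...     | c , d , refl , refl , cd = ⊥-elim (Edge-noncrossing isT (i<j , inj₂ e) cd x)
  entry : ∀ i j → enc (2 + n) tree [ i , j ] ≡ M [ i , j ]
  entry i j = trans (enc-entry tree i j) (does-≡ (IsDiag? tree i j) _ Mem⇒M M⇒Mem)
  M≡ : M ≡ enc (2 + n) tree
  M≡ = trans (sym (trans (tabulate-cong (λ i → tabulate∘lookup (lookup M i))) (tabulate∘lookup M)))
      (trans (tabulate-cong (λ i → tabulate-cong (λ j → sym (entry i j))))
             (trans (tabulate-cong (λ i → tabulate∘lookup (lookup (enc (2 + n) tree) i))) (tabulate∘lookup (enc (2 + n) tree))))

-- Colorful triangulations as labelled ternary trees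

Monoℕ : ℕ → ℕ → ℕ → Set
Monoℕ a b c = parity a ≡ parity b × parity b ≡ parity c

NoMono : Bin → ℕ → Set
NoMono leaf      p = ⊤
NoMono (bin l r) p = ¬ Monoℕ p (p + width l) (p + width l + width r) × NoMono l p × NoMono r (p + width l)

apex-≤ : ∀ {l r p b} → Mem (bin l r) p p b → b < p + width (bin l r) → b ≤ p + width l
apex-≤ (root refl) b<q = contradiction b<q (<-irrefl refl)
apex-≤ (inˡ e) _ = Mem-upper e
apex-≤ {l} (inʳ e) _ = contradiction (Mem-lower e) (<⇒≱ (p<end l _))

apex-≥ : ∀ {l r p b} → Mem (bin l r) p b (p + width (bin l r)) → p < b → p + width l ≤ b
apex-≥ (root _) p<b = contradiction p<b (<-irrefl refl)
apex-≥ {l} {r} {p} (inˡ e) _ = contradiction (Mem-upper e) (<⇒≱ (+-monoʳ-< p (m<m+n _ (0<width r))))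
apex-≥ (inʳ e) _ = Mem-lower e

-- The triangles of the triangulation given by t are exactly the inner nodes of t.
triangle-¬mono : ∀ t {p a b c} → NoMono t p → Mem t p a b → Mem t p b c → Mem t p a c → ¬ Monoℕ a b c
triangle-¬mono leaf {p} _ ab bc _ = contradiction (≤-trans (s≤s (≤-trans (s≤s (Mem-lower ab)) (Mem-< ab))) (Mem-< bc))
                                     (<⇒≱ (s≤s (≤-trans (Mem-upper bc) (≤-reflexive (+-comm p 1)))))
triangle-¬mono (bin l r) {p} {b = b} (n , _) ab bc (root refl) =
  subst₂ (λ m q → ¬ Monoℕ p m q) (≤-antisym (apex-≥ bc (Mem-< ab)) (apex-≤ ab (Mem-< bc))) (+-assoc p _ _) n
triangle-¬mono (bin l r) (_ , n , _) ab bc (inˡ ac) =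
  triangle-¬mono l n (Mem-restrictˡ ab (≤-trans (<⇒≤ (Mem-< bc)) (Mem-upper ac))) (Mem-restrictˡ bc (Mem-upper ac)) ac
triangle-¬mono (bin l r) (_ , _ , n) ab bc (inʳ ac) =
  triangle-¬mono r n (Mem-restrictʳ ab (Mem-lower ac)) (Mem-restrictʳ bc (≤-trans (Mem-lower ac) (<⇒≤ (Mem-< ab)))) ac

enc-colorful : ∀ {N t} → Spans N t → NoMono t 0 → Colorful (enc N t)
enc-colorful {t = t} S n a b c (ab , bc , ac) =
  triangle-¬mono t n (Edge⇒Mem S ab) (Edge⇒Mem S bc) (Edge⇒Mem S ac)

colorful-NoMono : ∀ {N t} → Spans N t → Colorful (enc N t) →
                  ∀ s p → (∀ {i j} → Mem s p i j → Mem t 0 i j) → NoMono s p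
colorful-NoMono S col leaf p sub = tt
colorful-NoMono {N} {t} S col (bin l r) p sub =
  ¬mono (sub (inˡ (root refl))) (sub (inʳ (root refl))) (sub (root (sym (+-assoc p _ _)))) ,
  colorful-NoMono S col l p (sub ∘ inˡ) , colorful-NoMono S col r (p + width l) (sub ∘ inʳ)
  where
  ¬mono : ∀ {a b c} → Mem t 0 a b → Mem t 0 b c → Mem t 0 a c → ¬ Monoℕ a b c
  ¬mono ab bc ac with Mem-fin S ab | Mem-fin S bc
  ... | i , j , refl , refl | j′ , k , j≡ , refl with toℕ-injective j≡
  ...   | refl = col i j k (Mem⇒Edge S ab , Mem⇒Edge S bc , Mem⇒Edge S ac)

-- A colorful triangulation is a quadrangulation by bichromatic diagonals, encoded as a
-- ternary tree, in which each quadrilateral is split by a monochromatic diagonal: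
-- from the first to the third corner for false, from the second to the fourth for true.
data Tree : Set where
  ∙    : Tree
  node : Bool → Tree → Tree → Tree → Tree

pattern F l m r = node false l m r
pattern T l m r = node true l m r

size : Tree → ℕ
size ∙ = 0
size (node _ l m r) = suc (size l + (size m + size r))

β : Tree → Bin
β ∙         = leaf
β (F l m r) = bin (bin (β l) (β m)) (β r)
β (T l m r) = bin (β l) (bin (β m) (β r))

width-β : ∀ t → width (β t) ≡ suc (2 * size t)
width-β ∙ = refl
width-β (F l m r) rewrite width-β l | width-β m | width-β r = arith (size l) (size m) (size r)
  where
  arith : ∀ (a b c : ℕ) → suc (2 * a) + suc (2 * b) + suc (2 * c) ≡ suc (2 * suc (a + (b + c)))
  arith = solve-∀
width-β (T l m r) rewrite width-β l | width-β m | width-β r = arith (size l) (size m) (size r)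
  where
  arith : ∀ (a b c : ℕ) → suc (2 * a) + (suc (2 * b) + suc (2 * c)) ≡ suc (2 * suc (a + (b + c)))
  arith = solve-∀

parity-suc : ∀ n → parity (suc n) ≡ not (parity n)
parity-suc zero = refl
parity-suc (suc zero) = refl
parity-suc (suc (suc n)) = parity-suc n

parity-+2* : ∀ p n → parity (p + 2 * n) ≡ parity p
parity-+2* p zero = cong parity (+-identityʳ p)
parity-+2* p (suc n) = trans (cong parity (arith p n)) (parity-+2* p n)
  where
  arith : ∀ (p n : ℕ) → p + 2 * suc n ≡ suc (suc (p + 2 * n))
  arith = solve-∀

-- A ternary tree has an odd number of leaves, so the segment it spans is bichromatic.
parity-β : ∀ p t → parity (p + width (β t)) ≡ not (parity p)
parity-β p t = begin
  parity (p + width (β t))         ≡⟨ cong (λ w → parity (p + w)) (width-β t) ⟩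
  parity (p + suc (2 * size t))    ≡⟨ cong parity (+-suc p _) ⟩
  parity (suc (p + 2 * size t))    ≡⟨ parity-suc (p + 2 * size t) ⟩
  not (parity (p + 2 * size t))    ≡⟨ cong not (parity-+2* p (size t)) ⟩
  not (parity p)                   ∎
  where open ≡-Reasoning

≢-not : ∀ {b c : Bool} → b ≡ not c → b ≢ c
≢-not eq eq′ = not-¬ eq′ eq

NoMono-bin : ∀ p s t → NoMono (β s) p → NoMono (β t) (p + width (β s)) → NoMono (bin (β s) (β t)) p
NoMono-bin p s t ns nt = (λ (e , _) → ≢-not (parity-β p s) (sym e)) , ns , nt

NoMono-β : ∀ t p → NoMono (β t) p
NoMono-β ∙ p = tt
NoMono-β (F l m r) p =
  (λ (_ , e) → ≢-not (parity-β (p + width (bin (β l) (β m))) r) (sym e)) ,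
  NoMono-bin p l m (NoMono-β l p) (NoMono-β m _) , NoMono-β r _
NoMono-β (T l m r) p =
  (λ (e , _) → ≢-not (parity-β p l) (sym e)) ,
  NoMono-β l p , NoMono-bin _ m r (NoMono-β m _) (NoMono-β r _)

Parse : Bin → ℕ → ℕ → Set
Parse t p q = (parity q ≡ not (parity p) → ∃[ s ] t ≡ β s)
            × (parity q ≡ parity p → ∃[ a ] ∃[ c ] t ≡ bin (β a) (β c))

-- Over a bichromatic segment the apex shares the colour of exactly one end, so one of the two other
-- sides is monochromatic, and together with the triangle behind it this gives a quadrilateral with
-- bichromatic sides. Over a monochromatic segment the apex has the other colour, and both sides are
-- bichromatic.
parse : ∀ t p → NoMono t p → Parse t p (p + width t)
parse leaf p _ = (λ _ → ∙ , refl) ,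
  λ e → contradiction e (≢-not (trans (cong parity (+-comm p 1)) (parity-suc p)))
parse (bin l r) p (n , nl , nr) = subst (Parse (bin l r) p) (+-assoc p _ _) (parse-bi , parse-mono)
  where
  m q : ℕ
  m = p + width l
  q = m + width r
  L : Parse l p m
  L = parse l p nl
  R : Parse r m q
  R = parse r m nr
  parse-bi : parity q ≡ not (parity p) → ∃[ s ] bin l r ≡ β s
  parse-bi e with either (parity p) (parity m)
  ... | inj₁ m≡p with proj₂ L m≡p | proj₁ R (trans e (cong not (sym m≡p)))
  ...   | a , b , refl | c , refl = F a b c , refl
  parse-bi e | inj₂ m≢p with proj₁ L m≢p | proj₂ R (trans e (sym m≢p))
  ...   | a , refl | b , c , refl = T a b c , refl
  parse-mono : parity q ≡ parity p → ∃[ a ] ∃[ c ] bin l r ≡ bin (β a) (β c)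
  parse-mono e with either (parity p) (parity m)
  ... | inj₁ m≡p = contradiction (sym m≡p , trans m≡p (sym e)) n
  ... | inj₂ m≢p with proj₁ L m≢p | proj₁ R (trans e (trans (sym (not-involutive _)) (cong not (sym m≢p))))
  ...   | a , refl | c , refl = a , c , refl

odd≢even : ∀ a b c → suc (2 * a) ≢ suc (2 * b) + suc (2 * c)
odd≢even a b c e = ≢-not {parity (suc (2 * a))} {false}
  (trans (parity-suc (2 * a)) (cong not (parity-+2* 0 a)))
  (trans (cong parity (trans e (arith b c))) (parity-+2* 0 (suc (b + c))))
  where
  arith : ∀ (b c : ℕ) → suc (2 * b) + suc (2 * c) ≡ 2 * suc (b + c)
  arith = solve-∀

-- An odd number of leaves against an even one. This is what tells the labels `false` and `true`
-- apart in `β-injective`.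
β≢bin : ∀ s a b → β s ≢ bin (β a) (β b)
β≢bin s a b e = odd≢even (size s) (size a) (size b)
  (trans (sym (width-β s)) (trans (cong width e) (cong₂ _+_ (width-β a) (width-β b))))

bin-injective : ∀ {a b c d} → bin a b ≡ bin c d → a ≡ c × b ≡ d
bin-injective refl = refl , refl

β-injective : ∀ s t → β s ≡ β t → s ≡ t
β-injective ∙ ∙ e = refl
β-injective ∙ (F _ _ _) ()
β-injective ∙ (T _ _ _) ()
β-injective (F _ _ _) ∙ ()
β-injective (T _ _ _) ∙ ()
β-injective (F l m r) (F l′ m′ r′) e with bin-injective e
... | e₁ , e₂ with bin-injective e₁
...   | e₃ , e₄ with β-injective l l′ e₃ | β-injective m m′ e₄ | β-injective r r′ e₂
...     | refl | refl | refl = refl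
β-injective (T l m r) (T l′ m′ r′) e with bin-injective e
... | e₁ , e₂ with bin-injective e₂
...   | e₃ , e₄ with β-injective l l′ e₁ | β-injective m m′ e₃ | β-injective r r′ e₄
...     | refl | refl | refl = refl
β-injective (F l m r) (T l′ m′ r′) e = contradiction (sym (proj₁ (bin-injective e))) (β≢bin l′ l m)
β-injective (T l m r) (F l′ m′ r′) e = contradiction (proj₁ (bin-injective e)) (β≢bin l l′ m′)

enc-node : ∀ {N t} → Spans N t → NoMono t 0 → IsNodeF (enc N t)
enc-node S n = enc-triangulation S , enc-colorful S n

node-enc : ∀ {n} {M : DiagMatrix (2 + n)} → IsNodeF M →
           ∃[ t ] (Spans (2 + n) t × NoMono t 0 × M ≡ enc (2 + n) t)
node-enc (isT , col) with enc-surjective isT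
... | t , S , refl = t , S , colorful-NoMono S col t 0 (λ e → e) , refl

spans-β : ∀ n t → size t ≡ n → Spans (2 + 2 * n) (β t)
spans-β n t refl = spans (cong suc (width-β t))

spans-pair : ∀ n a c → size a + size c ≡ n → Spans (3 + 2 * n) (bin (β a) (β c))
spans-pair n a c refl = spans (trans (cong₂ (λ x y → suc (x + y)) (width-β a) (width-β c)) (arith (size a) (size c)))
  where
  arith : ∀ (x y : ℕ) → suc (suc (2 * x) + suc (2 * y)) ≡ 3 + 2 * (x + y)
  arith = solve-∀

even-size : ∀ n s → Spans (2 + 2 * n) (β s) → size s ≡ n
even-size n s (spans w) = *-cancelˡ-≡ (size s) n 2 (suc-injective (trans (sym (width-β s)) (suc-injective w)))

odd-size : ∀ n a c → Spans (3 + 2 * n) (bin (β a) (β c)) → size a + size c ≡ n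
odd-size n a c (spans w) = *-cancelˡ-≡ (size a + size c) n 2 (+-cancelˡ-≡ 3 _ _
  (trans (sym (Spans.width≡ (spans-pair (size a + size c) a c refl))) w))

even-parity : ∀ n {w} → suc w ≡ 2 + 2 * n → parity w ≡ not (parity 0)
even-parity n refl = trans (parity-suc (2 * n)) (cong not (parity-+2* 0 n))

odd-parity : ∀ n {w} → suc w ≡ 3 + 2 * n → parity w ≡ parity 0
odd-parity n refl = parity-+2* 0 n

even-node : ∀ {n} {M : DiagMatrix (2 + 2 * n)} → IsNodeF M →
            ∃[ t ] (size t ≡ n × M ≡ enc (2 + 2 * n) (β t))
even-node {n} isN =
  let t , S , nm , M≡ = node-enc isN
      s , t≡ = proj₁ (parse t 0 nm) (even-parity n (Spans.width≡ S))
  in s , even-size n s (subst (Spans _) t≡ S) , trans M≡ (cong (enc _) t≡)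

odd-node : ∀ {n} {M : DiagMatrix (3 + 2 * n)} → IsNodeF M →
           ∃[ a ] ∃[ c ] (size a + size c ≡ n × M ≡ enc (3 + 2 * n) (bin (β a) (β c)))
odd-node {n} isN =
  let t , S , nm , M≡ = node-enc isN
      a , c , t≡ = proj₂ (parse t 0 nm) (odd-parity n (Spans.width≡ S))
  in a , c , odd-size n a c (subst (Spans _) t≡ S) , trans M≡ (cong (enc _) t≡)

-- Paths and gluing

data Path {A : Set} (R : A → A → Set) : A → A → List A → Set where
  end : ∀ {x} → Path R x x (x ∷ [])
  _∷_ : ∀ {x y z xs} → R x y → Path R y z xs → Path R x z (x ∷ xs)

-- One consecutive pair is in relation, not all of them. A proof is a position in the list, and
-- `insert` uses it as the place of insertion.
data Consec {A : Set} (E : A → A → Set) : List A → Set where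
  here  : ∀ {x y xs} → E x y → Consec E (x ∷ y ∷ xs)
  there : ∀ {x xs} → Consec E xs → Consec E (x ∷ xs)

module _ {A : Set} {R : A → A → Set} where

  path-++ : ∀ {x y y′ z xs ys} → Path R x y xs → R y y′ → Path R y′ z ys → Path R x z (xs ++ ys)
  path-++ end r q = r ∷ q
  path-++ (s ∷ p) r q = s ∷ path-++ p r q

  path-reverse : Symmetric R → ∀ {x y xs} → Path R x y xs → Path R y x (reverse xs)
  path-reverse s end = end
  path-reverse s (_∷_ {x} {xs = xs} r p) rewrite unfold-reverse x xs = path-++ (path-reverse s p) (s r) end

path-map : ∀ {A B : Set} {R : A → A → Set} {S : B → B → Set} (f : A → B) → (∀ {x y} → R x y → S (f x) (f y)) →
           ∀ {x y xs} → Path R x y xs → Path S (f x) (f y) (map f xs)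
path-map f g end = end
path-map f g (r ∷ p) = g r ∷ path-map f g p

consec-map : ∀ {A B : Set} {E : A → A → Set} {E′ : B → B → Set} (f : A → B) → (∀ {x y} → E x y → E′ (f x) (f y)) →
             ∀ {xs} → Consec E xs → Consec E′ (map f xs)
consec-map f g (here e) = here (g e)
consec-map f g (there h) = there (consec-map f g h)

module _ {A : Set} {E : A → A → Set} where

  consec-++ˡ : ∀ {xs ys} → Consec E xs → Consec E (xs ++ ys)
  consec-++ˡ (here e) = here e
  consec-++ˡ (there h) = there (consec-++ˡ h)

  consec-++ʳ : ∀ xs {ys} → Consec E ys → Consec E (xs ++ ys)
  consec-++ʳ [] h = h
  consec-++ʳ (x ∷ xs) h = there (consec-++ʳ xs h)

  consec-snoc : ∀ ys {x y} → E y x → Consec E ((ys ++ y ∷ []) ++ x ∷ [])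
  consec-snoc [] e = here e
  consec-snoc (_ ∷ ys) e = there (consec-snoc ys e)

  consec-reverse : Symmetric E → ∀ {xs} → Consec E xs → Consec E (reverse xs)
  consec-reverse s (here {x} {y} {xs} e)
    rewrite unfold-reverse x (y ∷ xs) | unfold-reverse y xs = consec-snoc (reverse xs) (s e)
  consec-reverse s (there {x} {xs} h) rewrite unfold-reverse x xs = consec-++ˡ (consec-reverse s h)

module _ {A : Set} {E : A → A → Set} where

  source target : ∀ {xs} → Consec E xs → A
  source (here {x} _) = x
  source (there h) = source h
  target (here {_} {y} _) = y
  target (there h) = target h

  related : ∀ {xs} (h : Consec E xs) → E (source h) (target h)
  related (here e) = e
  related (there h) = related h

  insert : ∀ {xs} → Consec E xs → List A → List A
  insert (here {x} {y} {xs} _) ds = x ∷ ds ++ y ∷ xs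
  insert (there {x} h) ds = x ∷ insert h ds

  insert-↭ : ∀ {xs} (h : Consec E xs) ds → insert h ds ↭ ds ++ xs
  insert-↭ (here {x} {y} {xs} _) ds = ↭-sym (shift x ds (y ∷ xs))
  insert-↭ (there {x} {xs} h) ds = ↭-trans (prep x (insert-↭ h ds)) (↭-sym (shift x ds xs))

  insert-path : ∀ {R : A → A → Set} {x z xs} (h : Consec E xs) {u v ds} →
                Path R x z xs → R (source h) u → Path R u v ds → R v (target h) → Path R x z (insert h ds)
  insert-path (here _) (_ ∷ p@end) r q s = r ∷ path-++ q s p
  insert-path (here _) (_ ∷ p@(_ ∷ _)) r q s = r ∷ path-++ q s p
  insert-path (there h) (t ∷ p) r q s = t ∷ insert-path h p r q s

  insert-consec-new : ∀ {E′ : A → A → Set} {xs} (h : Consec E xs) {ds} → Consec E′ ds → Consec E′ (insert h ds)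
  insert-consec-new (here _) h′ = there (consec-++ˡ h′)
  insert-consec-new (there h) h′ = there (insert-consec-new h h′)

  -- Insertion breaks only the pair at `h`; as this pair is not in `E′`, a witness for `E′` sits
  -- elsewhere and survives.
  insert-consec-old : ∀ {E′ : A → A → Set} {xs} (h : Consec E xs) {ds} →
                      ¬ E′ (source h) (target h) → Consec E′ xs → Consec E′ (insert h ds)
  insert-consec-old (here _) n (here e) = contradiction e n
  insert-consec-old (here _) {ds} n (there h′) = there (consec-++ʳ ds h′)
  insert-consec-old (there (here _)) n (here e) = here e
  insert-consec-old (there (there h)) n (here e) = here e
  insert-consec-old (there h) n (there h′) = there (insert-consec-old h n h′)

unique-resp-↭ : ∀ {A : Set} {xs ys : List A} → xs ↭ ys → Unique xs → Unique ys
unique-resp-↭ {A} p = PermutationSetoid.Unique-resp-↭ (setoid A) (↭⇒↭ₛ p)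

-- The vertices A are partitioned into blocks indexed by S, and each block into classes
-- indexed by K.
record Blocks : Set₁ where
  field
    {A S K} : Set
    _~_ _≈_ : A → A → Set
    block   : A → S
    class   : A → K
    home    : K → S
    Live    : K → Set

  InClass : K → A → A → Set
  InClass k a b = class a ≡ k × class b ≡ k × a ≈ b

  record BlockPath (c : S) (u v : A) : Set where
    field
      list     : List A
      path     : Path _~_ u v list
      sound    : ∀ {x} → x ∈ list → block x ≡ c
      complete : ∀ {x} → block x ≡ c → x ∈ list
      unique   : Unique list
      edges    : ∀ {k} → Live k → home k ≡ c → Consec (InClass k) list

-- Blocks are merged into one path along the forest Link: the block c is inserted into an
-- edge whose two ends lie in the class k, where Link c k.
record Gluing (𝔹 : Blocks) : Set₁ where
  open Blocks 𝔹
  field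
    Valid Start : S → Set
    Link    : S → K → Set
    rank    : S → ℕ
    _≟ₛ_     : DecidableEquality S
    link-injective : ∀ {c c′ k} → Link c k → Link c′ k → c ≡ c′
    link-rank  : ∀ {c k} → Link c k → rank (home k) < rank c
    link-valid : ∀ {c k} → Valid c → Link c k → Valid (home k)
    link-live  : ∀ {c k} → Link c k → Live k
    start-or-link : ∀ {c} → Valid c → Start c ⊎ ∃ (Link c)
    attach : ∀ {c k a b} → Valid c → Link c k → InClass k a b →
             ∃[ u ] ∃[ v ] (a ~ u × v ~ b × BlockPath c u v)

  -- The invariant is `edges`: a class keeps an edge until the block linked to it has been inserted.
  -- Classes that are the goal of no link keep theirs for good.
  record State (x y : A) (done : List S) : Set where
    field
      list     : List A
      path     : Path _~_ x y list
      unique   : Unique list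
      sound    : ∀ {a} → a ∈ list → block a ∈ done
      complete : ∀ {a} → block a ∈ done → a ∈ list
      valid    : ∀ {c} → c ∈ done → Valid c
      start    : ∀ {c} → Valid c → Start c → c ∈ done
      edges    : ∀ {k} → Live k → home k ∈ done → (∀ {c} → c ∈ done → ¬ Link c k) → Consec (InClass k) list

  extend : ∀ {x y done c k} → State x y done → c ∉ done → Valid c → Link c k → home k ∈ done → State x y (c ∷ done)
  extend {x} {y} {done} {c} {k} st c∉ vc lk hk = record
    { list = insert h B.list
    ; path = insert-path h St.path a~u B.path v~b
    ; unique = unique-resp-↭ (↭-sym (insert-↭ h B.list))
        (++⁺ B.unique St.unique λ (p , q) → c∉ (subst (_∈ done) (B.sound p) (St.sound q)))
    ; sound = λ m → [ (λ m′ → here (B.sound m′)) , (λ m′ → there (St.sound m′)) ]′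
        (∈-++⁻ B.list (∈-resp-↭ (insert-↭ h B.list) m))
    ; complete = λ { (here eq) → ∈-resp-↭ (↭-sym (insert-↭ h B.list)) (∈-++⁺ˡ (B.complete eq))
                   ; (there m) → ∈-resp-↭ (↭-sym (insert-↭ h B.list)) (∈-++⁺ʳ B.list (St.complete m)) }
    ; valid = λ { (here refl) → vc ; (there m) → St.valid m }
    ; start = λ v s → there (St.start v s)
    ; edges = edges
    }
    where
    module St = State st
    h : Consec (InClass k) St.list
    -- The class `k` is still intact: only `c` is linked to it, and `c` has not been inserted.
    h = St.edges (link-live lk) hk λ c′∈ lk′ → c∉ (subst (_∈ done) (link-injective lk′ lk) c′∈)
    glued : ∃[ u ] ∃[ v ] (source h ~ u × v ~ target h × BlockPath c u v)
    glued = attach vc lk (related h)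
    a~u = proj₁ (proj₂ (proj₂ glued))
    v~b = proj₁ (proj₂ (proj₂ (proj₂ glued)))
    module B = BlockPath (proj₂ (proj₂ (proj₂ (proj₂ glued))))
    edges : ∀ {k′} → Live k′ → home k′ ∈ c ∷ done → (∀ {c′} → c′ ∈ c ∷ done → ¬ Link c′ k′) →
            Consec (InClass k′) (insert h B.list)
    edges live (here eq) _ = insert-consec-new h (B.edges live eq)
    -- The broken edge lies in the class `k`. If it also lay in `k′`, then `k′` would be `k`, which
    -- `c` has now taken.
    edges {k′} live (there m) free = insert-consec-old h
      (λ (p , _) → free (here refl) (subst (Link c) (trans (sym (proj₁ (related h))) p) lk))
      (St.edges live m (free ∘ there))

  record Extension (x y : A) (done cs : List S) : Set where
    no-eta-equality
    pattern
    constructor extension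
    field
      {done′} : List S
      state   : State x y done′
      old     : done ⊆ done′
      new     : cs ⊆ done′

  -- The home block of the link is secured before `c`. Ranks drop on the way, so this ends at a
  -- block already in the path, at the latest a start block.
  ensure : ∀ {x y done} fuel c → rank c < fuel → Valid c → State x y done → Extension x y done (c ∷ [])
  ensure {done = done} (suc fuel) c (s≤s r≤) vc st with any? (c ≟ₛ_) done
  ... | yes c∈ = extension st (λ m → m) λ { (here refl) → c∈ }
  ... | no c∉ with start-or-link vc
  ...   | inj₁ s = contradiction (State.start st vc s) c∉
  ...   | inj₂ (k , lk) with ensure fuel (home k) (≤-trans (link-rank lk) r≤) (link-valid vc lk) st
  -- An extension only promises to contain certain blocks; it may already contain `c`, hence the
  -- second test.
  ...     | extension {done′} st′ old new with any? (c ≟ₛ_) done′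
  ...       | yes c∈ = extension st′ old λ { (here refl) → c∈ }
  ...       | no c∉′ = extension (extend st′ c∉′ vc lk (new (here refl))) (there ∘ old) λ { (here refl) → here refl }

  ensure-all : ∀ {x y done} cs → (∀ {c} → c ∈ cs → Valid c) → State x y done → Extension x y done cs
  ensure-all [] v st = extension st (λ m → m) λ ()
  ensure-all (c ∷ cs) v st with ensure (suc (rank c)) c (n<1+n _) (v (here refl)) st
  ... | extension st′ old new with ensure-all cs (v ∘ there) st′
  ...   | extension st″ old′ new′ = extension st″ (old′ ∘ old)
            λ { (here refl) → old′ (new (here refl)) ; (there m) → new′ m }

-- Hamilton paths in cubes

flip : ∀ {n} → Fin n → Vec Bool n → Vec Bool n
flip i v = updateAt v i not

data Neighbour {n} : Vec Bool n → Vec Bool n → Set where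
  flipped : ∀ {u} i → Neighbour u (flip i u)

ins : ∀ {n} → Fin (suc n) → Bool → Vec Bool n → Vec Bool (suc n)
ins d b x = insertAt x d b

flip-ins : ∀ {n} (d : Fin (suc n)) b x → flip d (ins d b x) ≡ ins d (not b) x
flip-ins zero b x = refl
flip-ins (suc d) b (y ∷ x) = cong (y ∷_) (flip-ins d b x)

flip-ins-punchIn : ∀ {n} (d : Fin (suc n)) b i x → flip (punchIn d i) (ins d b x) ≡ ins d b (flip i x)
flip-ins-punchIn zero b i x = refl
flip-ins-punchIn (suc d) b zero (y ∷ x) = refl
flip-ins-punchIn (suc d) b (suc i) (y ∷ x) = cong (y ∷_) (flip-ins-punchIn d b i x)

flip-involutive : ∀ {n} (d : Fin n) x → flip d (flip d x) ≡ x
flip-involutive zero (b ∷ x) = cong (_∷ x) (not-involutive b)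
flip-involutive (suc d) (b ∷ x) = cong (b ∷_) (flip-involutive d x)

neighbour-sym : ∀ {n} {u v : Vec Bool n} → Neighbour u v → Neighbour v u
neighbour-sym (flipped {u} i) = subst (Neighbour (flip i u)) (flip-involutive i u) (flipped i)

neighbour-across : ∀ {n} (d : Fin (suc n)) b x → Neighbour (ins d b x) (ins d (not b) x)
neighbour-across d b x = subst (Neighbour _) (flip-ins d b x) (flipped d)

neighbour-along : ∀ {n} (d : Fin (suc n)) b {x y} → Neighbour x y → Neighbour (ins d b x) (ins d b y)
neighbour-along d b (flipped {u} i) = subst (Neighbour _) (flip-ins-punchIn d b i u) (flipped (punchIn d i))

-- Every second step goes in direction d, so all edges in direction d are used.
zigzag : ∀ {n} → Fin (suc n) → Bool → List (Vec Bool n) → List (Vec Bool (suc n))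
zigzag d b []       = []
zigzag d b (x ∷ xs) = ins d b x ∷ ins d (not b) x ∷ zigzag d (not b) xs

-- The length modulo 2: `turn b xs` is the side on which the zigzag over `xs` ends, and
-- `turn b xs ≡ b` says that the length is even.
turn : ∀ {A : Set} → Bool → List A → Bool
turn b []       = b
turn b (x ∷ xs) = turn (not b) xs

zigzag-path : ∀ {n} (d : Fin (suc n)) b {x y xs} → Path Neighbour x y xs →
              Path Neighbour (ins d b x) (ins d (turn b xs) y) (zigzag d b xs)
zigzag-path d b {x} end = neighbour-across d b x ∷ end
zigzag-path d b {x} (r ∷ p) = neighbour-across d b x ∷ (neighbour-along d (not b) r ∷ zigzag-path d (not b) p)

turn-zigzag : ∀ {n} (d : Fin (suc n)) b c xs → turn c (zigzag d b xs) ≡ c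
turn-zigzag d b c [] = refl
turn-zigzag d b c (x ∷ xs) = trans (turn-zigzag d (not b) (not (not c)) xs) (not-involutive c)

turn-++ : ∀ {A : Set} b (xs ys : List A) → turn b (xs ++ ys) ≡ turn (turn b xs) ys
turn-++ b [] ys = refl
turn-++ b (x ∷ xs) ys = turn-++ (not b) xs ys

∈-zigzag⁺ : ∀ {n} (d : Fin (suc n)) b c {x xs} → x ∈ xs → ins d c x ∈ zigzag d b xs
∈-zigzag⁺ d b c (here refl) with either b c
... | inj₁ refl = here refl
... | inj₂ refl = there (here refl)
∈-zigzag⁺ d b c (there m) = there (there (∈-zigzag⁺ d (not b) c m))

∈-zigzag⁻ : ∀ {n} (d : Fin (suc n)) b {y} xs → y ∈ zigzag d b xs → ∃[ c ] ∃[ x ] (x ∈ xs × y ≡ ins d c x)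
∈-zigzag⁻ d b (x ∷ xs) (here eq) = b , x , here refl , eq
∈-zigzag⁻ d b (x ∷ xs) (there (here eq)) = not b , x , here refl , eq
∈-zigzag⁻ d b (x ∷ xs) (there (there m)) with ∈-zigzag⁻ d (not b) xs m
... | c , x′ , m′ , eq = c , x′ , there m′ , eq

ins-injective : ∀ {n} (d : Fin (suc n)) {b c x y} → ins d b x ≡ ins d c y → b ≡ c × x ≡ y
ins-injective d {b} {c} {x} {y} eq =
  trans (sym (insertAt-lookup x d b)) (trans (cong (λ v → lookup v d) eq) (insertAt-lookup y d c)) ,
  trans (sym (removeAt-insertAt x d b)) (trans (cong (λ v → removeAt v d) eq) (removeAt-insertAt y d c))

∉-zigzag : ∀ {n} (d : Fin (suc n)) b c {x} xs → x ∉ xs → ins d c x ∉ zigzag d b xs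
∉-zigzag d b c xs x∉ m with ∈-zigzag⁻ d b xs m
... | _ , _ , m′ , eq with ins-injective d eq
...   | _ , refl = x∉ m′

∉⇒All≢ : ∀ {A : Set} {x : A} xs → x ∉ xs → All (x ≢_) xs
∉⇒All≢ xs x∉ = All.tabulate λ m eq → x∉ (subst (_∈ xs) (sym eq) m)

All≢⇒∉ : ∀ {A : Set} {x : A} {xs} → All (x ≢_) xs → x ∉ xs
All≢⇒∉ a m = All.lookup a m refl

zigzag-unique : ∀ {n} (d : Fin (suc n)) b {xs} → Unique xs → Unique (zigzag d b xs)
zigzag-unique d b AllPairs.[] = AllPairs.[]
zigzag-unique d b {x ∷ xs} (x∉ AllPairs.∷ u) =
  ((λ eq → not-≡ b (sym (proj₁ (ins-injective d eq)))) ∷ fresh b) AllPairs.∷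
  fresh (not b) AllPairs.∷ zigzag-unique d (not b) u
  where
  fresh : ∀ c → All (ins d c x ≢_) (zigzag d (not b) xs)
  fresh c = ∉⇒All≢ _ (∉-zigzag d (not b) c xs (All≢⇒∉ x∉))

data EdgeAlong {n} (d : Fin n) (x : Vec Bool n) : Vec Bool n → Vec Bool n → Set where
  forward  : EdgeAlong d x x (flip d x)
  backward : EdgeAlong d x (flip d x) x

zigzag-consec : ∀ {n} (d : Fin (suc n)) b c {x xs} → x ∈ xs → Consec (EdgeAlong d (ins d c x)) (zigzag d b xs)
zigzag-consec d b c {x} (here refl) with either b c
... | inj₁ refl = here (subst (EdgeAlong d _ _) (flip-ins d b x) forward)
... | inj₂ refl = here (subst (λ y → EdgeAlong d (ins d (not b) x) y (ins d (not b) x))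
                    (trans (flip-ins d (not b) x) (cong (λ e → ins d e x) (not-involutive b))) backward)
zigzag-consec d b c (there m) = there (there (zigzag-consec d (not b) c m))

record CubePath {n} (u v : Vec Bool n) : Set where
  field
    list     : List (Vec Bool n)
    path     : Path Neighbour u v list
    complete : ∀ x → x ∈ list
    unique   : Unique list
    even     : ∀ b → turn b list ≡ b

-- From dimension two on, a Hamilton path from `u` to `flip d u` cannot contain the edge between its
-- own ends. This edge is excepted for all ends alike.
record CubePathAlong {n} (d : Fin n) (u v : Vec Bool n) : Set where
  field
    cubePath : CubePath u v
  open CubePath cubePath public
  field
    along : ∀ x → x ≢ u → x ≢ flip d u → Consec (EdgeAlong d x) list

data View {n} (d : Fin (suc n)) : Vec Bool (suc n) → Set where
  view : ∀ b x → View d (ins d b x)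

insView : ∀ {n} (d : Fin (suc n)) v → View d v
insView d v = subst (View d) (insertAt-removeAt v d) (view (lookup v d) (removeAt v d))

module _ {n : ℕ} where

  -- The ends are the two copies of `u`. The zigzag runs over the lower path without `u`; this has
  -- an odd number of vertices, so the zigzag ends at the copy of `v` on the opposite side, next to
  -- the second copy of `u`.
  closing-path : ∀ (d : Fin (2 + n)) b {u v} → CubePath u v → Neighbour v u → CubePathAlong d (ins d b u) (ins d (not b) u)
  closing-path d b record { path = end ; even = ev } r = contradiction (ev true) λ ()
  closing-path d b {u} {v} record { list = .(_ ∷ xs) ; path = _∷_ {xs = xs} s p ; complete = c ; unique = u∉ AllPairs.∷ un ; even = ev } r = record
    { cubePath = record
      { list = list
      ; path = neighbour-along d b s ∷ path-++ (zigzag-path d b p) (subst (λ e → Neighbour (ins d e v) _) (sym turned) (neighbour-along d (not b) r)) end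
      ; complete = λ x → complete x (insView d x)
      ; unique = ∉⇒All≢ _ first∉ AllPairs.∷ ++⁺ (zigzag-unique d b un) ([] AllPairs.∷ AllPairs.[]) λ { (m , here refl) → ∉-zigzag d b (not b) xs (All≢⇒∉ u∉) m }
      ; even = λ c → trans (turn-++ (not c) (zigzag d b xs) _) (trans (cong not (turn-zigzag d b (not c) xs)) (not-involutive c))
      }
    ; along = λ x → along x (insView d x)
    }
    where
    list : List (Vec Bool (2 + n))
    list = ins d b u ∷ zigzag d b xs ++ ins d (not b) u ∷ []
    turned : turn b xs ≡ not b
    turned = trans (cong (λ e → turn e xs) (sym (not-involutive b))) (ev (not b))
    first∉ : ins d b u ∉ zigzag d b xs ++ ins d (not b) u ∷ []
    first∉ m with ∈-++⁻ (zigzag d b xs) m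
    ... | inj₁ m′ = ∉-zigzag d b b xs (All≢⇒∉ u∉) m′
    ... | inj₂ (here eq) = not-≡ b (sym (proj₁ (ins-injective d eq)))
    complete : ∀ x → View d x → x ∈ list
    complete _ (view e x) with c x
    ... | there m = there (∈-++⁺ˡ (∈-zigzag⁺ d b e m))
    ... | here refl with either b e
    ...   | inj₁ refl = here refl
    ...   | inj₂ refl = there (∈-++⁺ʳ (zigzag d b xs) (here refl))
    along : ∀ x → View d x → x ≢ ins d b u → x ≢ flip d (ins d b u) → Consec (EdgeAlong d x) list
    along _ (view e x) x≢ x≢′ with c x
    ... | there m = there (consec-++ˡ (zigzag-consec d b e m))
    ... | here refl with either b e
    ...   | inj₁ refl = contradiction refl x≢
    ...   | inj₂ refl = contradiction (sym (flip-ins d b u)) x≢′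

  zigzag-cubePath : ∀ (d : Fin (2 + n)) b {u v} → CubePath u v → CubePathAlong d (ins d b u) (ins d b v)
  zigzag-cubePath d b {u} {v} record { list = xs ; path = p ; complete = c ; unique = un ; even = ev } = record
    { cubePath = record
      { list = zigzag d b xs
      ; path = subst (λ e → Path Neighbour (ins d b u) (ins d e v) (zigzag d b xs)) (ev b) (zigzag-path d b p)
      ; complete = λ x → complete x (insView d x)
      ; unique = zigzag-unique d b un
      ; even = λ c → turn-zigzag d b c xs
      }
    ; along = λ x _ _ → along x (insView d x)
    }
    where
    complete : ∀ x → View d x → x ∈ zigzag d b xs
    complete _ (view e x) = ∈-zigzag⁺ d b e (c x)
    along : ∀ x → View d x → Consec (EdgeAlong d x) (zigzag d b xs)
    along _ (view e x) = zigzag-consec d b e (c x)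

  -- The ends differ either in the zigzag direction `d`, and a lower path between neighbours is
  -- closed up, or in another direction, and the zigzag over a lower path of even length returns to
  -- the side it started from.
  cubePathAlong-step : (∀ (i : Fin (suc n)) u → CubePath u (flip i u)) → ∀ d i u → CubePathAlong d u (flip i u)
  cubePathAlong-step cube d i u with insView d u | d Fin.≟ i
  ... | view b x | yes refl = subst (CubePathAlong d _) (sym (flip-ins d b x))
                                (closing-path d b (cube zero x) (neighbour-sym (flipped zero)))
  ... | view b x | no d≢i = subst (CubePathAlong d _)
                              (trans (sym (flip-ins-punchIn d b (punchOut d≢i) x)) (cong (λ j → flip j (ins d b x)) (punchIn-punchOut d≢i)))
                              (zigzag-cubePath d b (cube (punchOut d≢i) x))

cubePath : ∀ {n} (i : Fin (suc n)) u → CubePath u (flip i u)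
cubePath {zero} zero (b ∷ []) = record
  { list = (b ∷ []) ∷ (not b ∷ []) ∷ []
  ; path = flipped zero ∷ end
  ; complete = λ { (c ∷ []) → [ (λ { refl → here refl }) , (λ { refl → there (here refl) }) ]′ (either b c) }
  ; unique = ((λ eq → not-≡ b (sym (cong (λ v → lookup v zero) eq))) ∷ []) AllPairs.∷ [] AllPairs.∷ AllPairs.[]
  ; even = not-involutive
  }
cubePath {suc n} i u = CubePathAlong.cubePath (cubePathAlong-step cubePath zero i u)

cubePathAlong : ∀ {n} (d i : Fin (2 + n)) u → CubePathAlong d u (flip i u)
cubePathAlong = cubePathAlong-step cubePath

cubePathAlong′ : ∀ {n} → 2 ≤ n → (d i : Fin n) (u : Vec Bool n) → CubePathAlong d u (flip i u)
cubePathAlong′ (s≤s (s≤s _)) = cubePathAlong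

-- Blocks that are cubes

record CubeBlock (𝔹 : Blocks) (c : Blocks.S 𝔹) {n : ℕ} (code : Vec Bool n → Blocks.A 𝔹) : Set where
  open Blocks 𝔹
  field
    2≤n       : 2 ≤ n
    injective : ∀ {u v} → code u ≡ code v → u ≡ v
    code-block : ∀ v → block (code v) ≡ c
    onto      : ∀ {a} → block a ≡ c → ∃[ v ] a ≡ code v
    adjacent  : ∀ {u v} → Neighbour u v → code u ~ code v
    close     : ∀ {u v} → Neighbour u v → code u ≈ code v
    direction : Fin n
    spread    : ∀ u {k} → Live k → home k ≡ c →
                ∃[ x ] (x ≢ u × x ≢ flip direction u × class (code x) ≡ k × class (code (flip direction x)) ≡ k)

  -- For every start `u`, `spread` finds in each live class an edge in the fixed direction other
  -- than the one at `u`, and the zigzag path passes through it.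
  blockPath : ∀ i u → BlockPath c (code u) (code (flip i u))
  blockPath i u = record
    { list = map code P.list
    ; path = path-map code adjacent P.path
    ; sound = λ m → let v , _ , eq = ∈-map⁻ code m in trans (cong block eq) (code-block v)
    ; complete = λ e → let v , eq = onto e in subst (_∈ map code P.list) (sym eq) (∈-map⁺ code (P.complete v))
    ; unique = map⁺ injective P.unique
    ; edges = λ live hk → let x , x≢ , x≢′ , e , e′ = spread u live hk in
        consec-map code (λ { forward → e , e′ , close (flipped direction)
                           ; backward → e′ , e , close (neighbour-sym (flipped direction)) }) (P.along x x≢ x≢′)
    }
    where module P = CubePathAlong (cubePathAlong′ 2≤n direction i u)

module _ {n : ℕ} {z s t d : Fin n} (z≢s : z ≢ s) (z≢t : z ≢ t) (z≢d : z ≢ d) (s≢t : s ≢ t) (s≢d : s ≢ d) (t≢d : t ≢ d) where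

  -- The coordinates `z` and `s` receive the prescribed labels, `t` keeps `x` away from both ends of
  -- the edge at `u`, and `d` is the direction of the edge at `x`: four coordinates in all.
  away-from : ∀ (u : Vec Bool n) b c → ∃[ x ]
              (x ≢ u × x ≢ flip d u × (lookup x z ≡ b × lookup x s ≡ c) × (lookup (flip d x) z ≡ b × lookup (flip d x) s ≡ c))
  away-from u b c = x ,
    (λ eq → at-t (cong (λ v → lookup v t) eq)) ,
    (λ eq → at-t (trans (cong (λ v → lookup v t) eq) (lookup∘updateAt′ t d t≢d u))) ,
    (at-z , at-s) ,
    (trans (lookup∘updateAt′ z d z≢d x) at-z , trans (lookup∘updateAt′ s d s≢d x) at-s)
    where
    x₁ x₂ x : Vec Bool n
    x₁ = u [ t ]≔ not (lookup u t)
    x₂ = x₁ [ s ]≔ c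
    x  = x₂ [ z ]≔ b
    at-z : lookup x z ≡ b
    at-z = lookup∘update z x₂ b
    at-s : lookup x s ≡ c
    at-s = trans (lookup∘update′ (z≢s ∘ sym) x₂ b) (lookup∘update s x₁ c)
    at-t : lookup x t ≢ lookup u t
    at-t eq = not-≡ (lookup u t) (trans (sym (trans (lookup∘update′ (z≢t ∘ sym) x₂ b)
                (trans (lookup∘update′ (s≢t ∘ sym) x₁ c) (lookup∘update t u _)))) eq)

away-from₁ : ∀ {n} {z t d : Fin n} → z ≢ t → z ≢ d → t ≢ d → ∀ (u : Vec Bool n) b →
             ∃[ x ] (x ≢ u × x ≢ flip d u × lookup x z ≡ b × lookup (flip d x) z ≡ b)
away-from₁ {n} {z} {t} {d} z≢t z≢d t≢d u b = x ,
  (λ eq → at-t (cong (λ v → lookup v t) eq)) ,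
  (λ eq → at-t (trans (cong (λ v → lookup v t) eq) (lookup∘updateAt′ t d t≢d u))) ,
  lookup∘update z x₁ b , trans (lookup∘updateAt′ z d z≢d x) (lookup∘update z x₁ b)
  where
  x₁ x : Vec Bool n
  x₁ = u [ t ]≔ not (lookup u t)
  x  = x₁ [ z ]≔ b
  at-t : lookup x t ≢ lookup u t
  at-t eq = not-≡ (lookup u t) (trans (sym (trans (lookup∘update′ (z≢t ∘ sym) x₁ b) (lookup∘update t u _))) eq)

-- The even case

data _~_ : Tree → Tree → Set where
  rotation : ∀ {s t} → β s ⇄ β t → s ~ t

-- The flip of one monochromatic diagonal.
data _≈_ : Tree → Tree → Set where
  turnᵇ : ∀ {b l m r} → node b l m r ≈ node (not b) l m r
  inˡ   : ∀ {b l l′ m r} → l ≈ l′ → node b l m r ≈ node b l′ m r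
  inᵐ   : ∀ {b l m m′ r} → m ≈ m′ → node b l m r ≈ node b l m′ r
  inʳ   : ∀ {b l m r r′} → r ≈ r′ → node b l m r ≈ node b l m r′

⇄-sym : ∀ {s t} → s ⇄ t → t ⇄ s
⇄-sym (inj₁ ρ) = inj₂ ρ
⇄-sym (inj₂ ρ) = inj₁ ρ

~-sym : ∀ {s t} → s ~ t → t ~ s
~-sym (rotation ρ) = rotation (⇄-sym ρ)

⇄-onˡ : ∀ {l l′ r} → l ⇄ l′ → bin l r ⇄ bin l′ r
⇄-onˡ (inj₁ ρ) = inj₁ (onˡ ρ)
⇄-onˡ (inj₂ ρ) = inj₂ (onˡ ρ)

⇄-onʳ : ∀ {l r r′} → r ⇄ r′ → bin l r ⇄ bin l r′
⇄-onʳ (inj₁ ρ) = inj₁ (onʳ ρ)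
⇄-onʳ (inj₂ ρ) = inj₂ (onʳ ρ)

~-left : ∀ b {l l′ m r} → l ~ l′ → node b l m r ~ node b l′ m r
~-left false (rotation ρ) = rotation (⇄-onˡ (⇄-onˡ ρ))
~-left true  (rotation ρ) = rotation (⇄-onˡ ρ)

≈⇒⇄ : ∀ {s t} → s ≈ t → β s ⇄ β t
≈⇒⇄ (turnᵇ {false}) = inj₁ here
≈⇒⇄ (turnᵇ {true})  = inj₂ here
≈⇒⇄ (inˡ {false} e) = ⇄-onˡ (⇄-onˡ (≈⇒⇄ e))
≈⇒⇄ (inˡ {true} e)  = ⇄-onˡ (≈⇒⇄ e)
≈⇒⇄ (inᵐ {false} e) = ⇄-onˡ (⇄-onʳ (≈⇒⇄ e))
≈⇒⇄ (inᵐ {true} e)  = ⇄-onʳ (⇄-onˡ (≈⇒⇄ e))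
≈⇒⇄ (inʳ {false} e) = ⇄-onʳ (≈⇒⇄ e)
≈⇒⇄ (inʳ {true} e)  = ⇄-onʳ (⇄-onʳ (≈⇒⇄ e))

≈-sym : ∀ {s t} → s ≈ t → t ≈ s
≈-sym (turnᵇ {false}) = turnᵇ
≈-sym (turnᵇ {true})  = turnᵇ
≈-sym (inˡ e) = inˡ (≈-sym e)
≈-sym (inᵐ e) = inᵐ (≈-sym e)
≈-sym (inʳ e) = inʳ (≈-sym e)

-- The cube of labellings of a fixed shape

data Shape : Set where
  ⊙  : Shape
  nd : Shape → Shape → Shape → Shape

sizeˢ : Shape → ℕ
sizeˢ ⊙ = 0
sizeˢ (nd l m r) = suc (sizeˢ l + (sizeˢ m + sizeˢ r))

shape : Tree → Shape
shape ∙ = ⊙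
shape (node _ l m r) = nd (shape l) (shape m) (shape r)

size-shape : ∀ t → sizeˢ (shape t) ≡ size t
size-shape ∙ = refl
size-shape (node _ l m r) = cong suc (cong₂ _+_ (size-shape l) (cong₂ _+_ (size-shape m) (size-shape r)))

fill : ∀ q → Vec Bool (sizeˢ q) → Tree
fill ⊙ _ = ∙
fill (nd l m r) (b ∷ v) =
  node b (fill l (take (sizeˢ l) v))
         (fill m (take (sizeˢ m) (drop (sizeˢ l) v)))
         (fill r (drop (sizeˢ m) (drop (sizeˢ l) v)))

labels : ∀ q → Tree → Vec Bool (sizeˢ q)
labels ⊙ _ = []
-- A default for a tree that does not have the shape. The labels are otherwise listed in preorder,
-- which puts the left root at position 1 and the middle root right after the left subtree.
labels (nd l m r) ∙ = replicate _ false
labels (nd l m r) (node b x y z) = b ∷ labels l x ++ᵛ (labels m y ++ᵛ labels r z)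

take-++ : ∀ {A : Set} {m n} (u : Vec A m) (v : Vec A n) → take m (u ++ᵛ v) ≡ u
take-++ [] v = refl
take-++ (x ∷ u) v = cong (x ∷_) (take-++ u v)

drop-++ : ∀ {A : Set} {m n} (u : Vec A m) (v : Vec A n) → drop m (u ++ᵛ v) ≡ v
drop-++ [] v = refl
drop-++ (x ∷ u) v = drop-++ u v

shape-fill : ∀ q v → shape (fill q v) ≡ q
shape-fill ⊙ v = refl
shape-fill (nd l m r) (b ∷ v) rewrite shape-fill l (take (sizeˢ l) v)
  | shape-fill m (take (sizeˢ m) (drop (sizeˢ l) v)) | shape-fill r (drop (sizeˢ m) (drop (sizeˢ l) v)) = refl

fill-labels : ∀ t → fill (shape t) (labels (shape t) t) ≡ t
fill-labels ∙ = refl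
fill-labels (node b x y z)
  rewrite take-++ (labels (shape x) x) (labels (shape y) y ++ᵛ labels (shape z) z)
        | drop-++ (labels (shape x) x) (labels (shape y) y ++ᵛ labels (shape z) z)
        | take-++ (labels (shape y) y) (labels (shape z) z)
        | drop-++ (labels (shape y) y) (labels (shape z) z)
        | fill-labels x | fill-labels y | fill-labels z = refl

labels-fill : ∀ q v → labels q (fill q v) ≡ v
labels-fill ⊙ [] = refl
labels-fill (nd l m r) (b ∷ v)
  rewrite labels-fill l (take (sizeˢ l) v)
        | labels-fill m (take (sizeˢ m) (drop (sizeˢ l) v)) | labels-fill r (drop (sizeˢ m) (drop (sizeˢ l) v))
        | take++drop≡id (sizeˢ m) (drop (sizeˢ l) v) | take++drop≡id (sizeˢ l) v = refl

fill-injective : ∀ q {u v} → fill q u ≡ fill q v → u ≡ v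
fill-injective q {u} {v} eq = trans (sym (labels-fill q u)) (trans (cong (labels q) eq) (labels-fill q v))

neighbour-∷ : ∀ {n} b {u v : Vec Bool n} → Neighbour u v → Neighbour (b ∷ u) (b ∷ v)
neighbour-∷ b (flipped i) = flipped (suc i)

neighbour-++ˡ : ∀ {m n} {u u′ : Vec Bool m} (v : Vec Bool n) → Neighbour u u′ → Neighbour (u ++ᵛ v) (u′ ++ᵛ v)
neighbour-++ˡ v (flipped {x ∷ u} zero) = flipped zero
neighbour-++ˡ v (flipped {x ∷ u} (suc i)) = neighbour-∷ x (neighbour-++ˡ v (flipped i))

neighbour-++ʳ : ∀ {m n} (u : Vec Bool m) {v v′ : Vec Bool n} → Neighbour v v′ → Neighbour (u ++ᵛ v) (u ++ᵛ v′)
neighbour-++ʳ [] e = e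
neighbour-++ʳ (x ∷ u) e = neighbour-∷ x (neighbour-++ʳ u e)

neighbour-split : ∀ m {n} {u v : Vec Bool (m + n)} → Neighbour u v →
                  (Neighbour (take m u) (take m v) × drop m u ≡ drop m v)
                  ⊎ (take m u ≡ take m v × Neighbour (drop m u) (drop m v))
neighbour-split zero e = inj₂ (refl , e)
neighbour-split (suc m) (flipped {x ∷ u} zero) = inj₁ (flipped zero , refl)
neighbour-split (suc m) (flipped {x ∷ u} (suc i)) with neighbour-split m (flipped {u = u} i)
... | inj₁ (e , eq) = inj₁ (neighbour-∷ x e , eq)
... | inj₂ (eq , e) = inj₂ (cong (x ∷_) eq , e)

fill-≈ : ∀ q {u v} → Neighbour u v → fill q u ≈ fill q v
fill-≈ ⊙ (flipped ())
fill-≈ (nd l m r) (flipped {b ∷ v} zero) = turnᵇ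
fill-≈ (nd l m r) (flipped {b ∷ v} (suc i)) with neighbour-split (sizeˢ l) (flipped {u = v} i)
... | inj₁ (e , eq) rewrite eq = inˡ (fill-≈ l e)
... | inj₂ (eq , e) rewrite eq with neighbour-split (sizeˢ m) e
...   | inj₁ (e′ , eq′) rewrite eq′ = inᵐ (fill-≈ m e′)
...   | inj₂ (eq′ , e′) rewrite eq′ = inʳ (fill-≈ r e′)

shape-≈ : ∀ {s t} → s ≈ t → shape s ≡ shape t
shape-≈ turnᵇ = refl
shape-≈ (inˡ e) rewrite shape-≈ e = refl
shape-≈ (inᵐ e) rewrite shape-≈ e = refl
shape-≈ (inʳ e) rewrite shape-≈ e = refl

labels-≈ : ∀ {s t} → s ≈ t → Neighbour (labels (shape s) s) (labels (shape s) t)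
labels-≈ turnᵇ = flipped zero
labels-≈ (inˡ e) = neighbour-∷ _ (neighbour-++ˡ _ (labels-≈ e))
labels-≈ (inᵐ {l = l} e) = neighbour-∷ _ (neighbour-++ʳ (labels (shape l) l) (neighbour-++ˡ _ (labels-≈ e)))
labels-≈ (inʳ {l = l} {m} e) =
  neighbour-∷ _ (neighbour-++ʳ (labels (shape l) l) (neighbour-++ʳ (labels (shape m) m) (labels-≈ e)))

rootBit : Tree → Bool
-- An empty subtree counts as labelled `false`, so a class that asks for `true` at an empty child
-- contains no tree; `Live` rules it out.
rootBit ∙ = false
rootBit (node b _ _ _) = b

rootBit-fill-take : ∀ q {n} {v : Vec Bool (sizeˢ q + n)} (i : Fin (sizeˢ q + n)) → 0 < sizeˢ q → toℕ i ≡ 0 →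
                    rootBit (fill q (take (sizeˢ q) v)) ≡ lookup v i
rootBit-fill-take (nd l m r) {v = b ∷ v} zero _ refl = refl

rootBit-fill-mid : ∀ k q {n} {v : Vec Bool (k + (sizeˢ q + n))} (i : Fin (k + (sizeˢ q + n))) → 0 < sizeˢ q → toℕ i ≡ k →
                   rootBit (fill q (take (sizeˢ q) (drop k v))) ≡ lookup v i
rootBit-fill-mid zero q i = rootBit-fill-take q i
rootBit-fill-mid (suc k) q {v = b ∷ v} (suc i) p eq = rootBit-fill-mid k q i p (suc-injective eq)

fromℕ<-≢ : ∀ {n a b} (p : a < n) (q : b < n) → a ≢ b → fromℕ< p ≢ fromℕ< q
fromℕ<-≢ p q a≢b eq = a≢b (fromℕ<-injective _ _ p q eq)

-- s and t are the positions of the roots of the left and middle subtree, if these are not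
-- empty, and d is a further position.
record Positions (x y z : ℕ) : Set where
  field
    s t d : Fin (suc (x + (y + z)))
    0≢s : zero ≢ s
    0≢t : zero ≢ t
    0≢d : zero ≢ d
    s≢t : s ≢ t
    s≢d : s ≢ d
    t≢d : t ≢ d
    s≡  : 0 < x → toℕ s ≡ 1
    t≡  : 0 < y → toℕ t ≡ suc x

positions : ∀ x y z → 4 ≤ suc (x + (y + z)) → Positions x y z
positions x y z 4≤ = choose x y z 4≤
  where
  make : ∀ {x y z} i j k → (0< : 0 < suc (x + (y + z))) (i< : i < suc (x + (y + z))) (j< : j < suc (x + (y + z))) (k< : k < suc (x + (y + z))) →
         0 ≢ i → 0 ≢ j → 0 ≢ k → i ≢ j → i ≢ k → j ≢ k → (0 < x → i ≡ 1) → (0 < y → j ≡ suc x) → Positions x y z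
  make i j k 0< i< j< k< a b c d e f g h = record
    { s = fromℕ< i< ; t = fromℕ< j< ; d = fromℕ< k<
    ; 0≢s = fromℕ<-≢ (s≤s z≤n) i< a ; 0≢t = fromℕ<-≢ (s≤s z≤n) j< b ; 0≢d = fromℕ<-≢ (s≤s z≤n) k< c
    ; s≢t = fromℕ<-≢ i< j< d ; s≢d = fromℕ<-≢ i< k< e ; t≢d = fromℕ<-≢ j< k< f
    ; s≡ = λ p → trans (toℕ-fromℕ< i<) (g p) ; t≡ = λ p → trans (toℕ-fromℕ< j<) (h p) }
  choose : ∀ x y z → 4 ≤ suc (x + (y + z)) → Positions x y z
  choose zero y z p =
    make 2 1 3 (s≤s z≤n) (≤-trans (s≤s (s≤s (s≤s z≤n))) p) (≤-trans (s≤s (s≤s z≤n)) p) p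
      (λ ()) (λ ()) (λ ()) (λ ()) (λ ()) (λ ()) (λ ()) (λ _ → refl)
  choose (suc zero) y z p =
    make 1 2 3 (s≤s z≤n) (≤-trans (s≤s (s≤s z≤n)) p) (≤-trans (s≤s (s≤s (s≤s z≤n))) p) p
      (λ ()) (λ ()) (λ ()) (λ ()) (λ ()) (λ ()) (λ _ → refl) (λ _ → refl)
  choose (suc (suc x)) zero z p =
    make 1 2 3 (s≤s z≤n) (≤-trans (s≤s (s≤s z≤n)) p) (≤-trans (s≤s (s≤s (s≤s z≤n))) p) p
      (λ ()) (λ ()) (λ ()) (λ ()) (λ ()) (λ ()) (λ _ → refl) (λ ())
  -- The left subtree has at least two nodes, so position 2 lies inside it, between its root at 1
  -- and the middle root at `3 + x`.
  choose (suc (suc x)) (suc y) z p =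
    make 1 (3 + x) 2 (s≤s z≤n) (≤-trans (s≤s (s≤s z≤n)) p)
      (s≤s (s≤s (s≤s (≤-trans (m≤m+n (suc x) (y + z)) (≤-reflexive (sym (+-suc x (y + z))))))))
      (≤-trans (s≤s (s≤s (s≤s z≤n))) p)
      (λ ()) (λ ()) (λ ()) (λ ()) (λ ()) (λ ()) (λ _ → refl) (λ _ → refl)

-- The second bit is the label of the left child or of the middle child of the root,
-- depending on the first bit, which is the label of the root itself.
slot : Tree → Bool × Bool
slot ∙ = false , false
slot (node b l m r) = b , (if b then rootBit m else rootBit l)

child : Bool → Shape → Shape
child b ⊙ = ⊙
child b (nd l m r) = if b then m else l

-- Each cube falls into four classes: `(false , true)` can receive the cube linked by `mid`,
-- `(true , true)` the one linked by `right`, and those with second bit `false` are kept for the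
-- next size.
treeBlocks : Blocks
treeBlocks = record
  { A = Tree ; S = Shape ; K = Shape × Bool × Bool
  ; _~_ = _~_ ; _≈_ = _≈_
  ; block = shape
  ; class = λ t → shape t , slot t
  ; home = proj₁
  ; Live = λ (q , b , c) → c ≡ true → 0 < sizeˢ (child b q)
  }

open Blocks treeBlocks using (Live; InClass; BlockPath; class)

rootBit-fill : ∀ q {u : Vec Bool (sizeˢ q)} {b c} → (c ≡ true → 0 < sizeˢ q) →
               (0 < sizeˢ q → rootBit (fill q u) ≡ b) → b ≡ c → rootBit (fill q u) ≡ c
rootBit-fill ⊙ {c = false} live e eq = refl
rootBit-fill ⊙ {c = true} live e eq = contradiction (live refl) λ ()
rootBit-fill (nd l m r) live e eq = trans (e (s≤s z≤n)) eq

module _ (l m r : Shape) (P : Positions (sizeˢ l) (sizeˢ m) (sizeˢ r)) where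
  open Positions P

  slot-fill : ∀ b c x → Live (nd l m r , b , c) → lookup x zero ≡ b → lookup x (if b then t else s) ≡ c →
              class (fill (nd l m r) x) ≡ (nd l m r , b , c)
  slot-fill false c x@(false ∷ v) live refl e = cong₂ _,_ (shape-fill (nd l m r) x)
    (cong (false ,_) (rootBit-fill l live (λ p → rootBit-left p s 0≢s (s≡ p)) e))
    where
    rootBit-left : 0 < sizeˢ l → ∀ i → zero ≢ i → toℕ i ≡ 1 → rootBit (fill l (take (sizeˢ l) v)) ≡ lookup x i
    rootBit-left p zero 0≢ _ = contradiction refl 0≢
    rootBit-left p (suc i) _ eq = rootBit-fill-take l i p (suc-injective eq)
  slot-fill true c x@(true ∷ v) live refl e = cong₂ _,_ (shape-fill (nd l m r) x)
    (cong (true ,_) (rootBit-fill m live (λ p → rootBit-mid p t 0≢t (t≡ p)) e))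
    where
    rootBit-mid : 0 < sizeˢ m → ∀ i → zero ≢ i → toℕ i ≡ suc (sizeˢ l) →
                  rootBit (fill m (take (sizeˢ m) (drop (sizeˢ l) v))) ≡ lookup x i
    rootBit-mid p zero 0≢ _ = contradiction refl 0≢
    rootBit-mid p (suc i) _ eq = rootBit-fill-mid (sizeˢ l) m i p (suc-injective eq)

  spread-tree : ∀ u {k} → Live k → proj₁ k ≡ nd l m r → ∃[ x ] (x ≢ u × x ≢ flip d u ×
                class (fill (nd l m r) x) ≡ k × class (fill (nd l m r) (flip d x)) ≡ k)
  spread-tree u {_ , false , c} live refl with away-from 0≢s 0≢t 0≢d s≢t s≢d t≢d u false c
  ... | x , x≢ , x≢′ , (e , f) , (e′ , f′) = x , x≢ , x≢′ , slot-fill false c x live e f , slot-fill false c (flip d x) live e′ f′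
  -- Under root label `true` the prescribed child is the middle one, so `s` and `t` exchange their
  -- roles.
  spread-tree u {_ , true , c} live refl with away-from 0≢t 0≢s 0≢d (s≢t ∘ sym) t≢d s≢d u true c
  ... | x , x≢ , x≢′ , (e , f) , (e′ , f′) = x , x≢ , x≢′ , slot-fill true c x live e f , slot-fill true c (flip d x) live e′ f′

≈⇒~ : ∀ {s t} → s ≈ t → s ~ t
≈⇒~ e = rotation (≈⇒⇄ e)

fill-onto : ∀ q {t} → shape t ≡ q → t ≡ fill q (labels q t)
fill-onto q {t} refl = sym (fill-labels t)

treeBlock : ∀ q → 4 ≤ sizeˢ q → CubeBlock treeBlocks q (fill q)
treeBlock q@(nd l m r) 4≤ = record
  { 2≤n = ≤-trans (s≤s (s≤s z≤n)) 4≤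
  ; injective = fill-injective q
  ; code-block = shape-fill q
  ; onto = λ {t} e → labels q t , fill-onto q e
  ; adjacent = ≈⇒~ ∘ fill-≈ q
  ; close = fill-≈ q
  ; direction = Positions.d P
  ; spread = spread-tree l m r P
  }
  where
  P : Positions (sizeˢ l) (sizeˢ m) (sizeˢ r)
  P = positions (sizeˢ l) (sizeˢ m) (sizeˢ r) 4≤

treeBlockPath : ∀ {q u v} → 4 ≤ sizeˢ q → shape u ≡ q → u ≈ v → BlockPath q u v
treeBlockPath {u = u} {v} 4≤ refl e = subst₂ (BlockPath (shape u)) (fill-labels u) v≡ bp
  where
  nb : ∀ {w} → Neighbour (labels (shape u) u) w → ∃[ i ] w ≡ flip i (labels (shape u) u)
  nb (flipped i) = i , refl
  i = proj₁ (nb (labels-≈ e))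
  bp : BlockPath (shape u) (fill (shape u) (labels (shape u) u)) (fill (shape u) (flip i (labels (shape u) u)))
  bp = CubeBlock.blockPath (treeBlock (shape u) 4≤) i (labels (shape u) u)
  v≡ : fill (shape u) (flip i (labels (shape u) u)) ≡ v
  v≡ = trans (cong (fill (shape u)) (sym (proj₂ (nb (labels-≈ e))))) (sym (fill-onto (shape u) (sym (shape-≈ e))))

_≟ˢ_ : DecidableEquality Shape
⊙ ≟ˢ ⊙ = yes refl
⊙ ≟ˢ nd _ _ _ = no λ ()
nd _ _ _ ≟ˢ ⊙ = no λ ()
nd l m r ≟ˢ nd l′ m′ r′ = map′ (λ { (refl , refl , refl) → refl }) (λ { refl → refl , refl , refl })
                            ((l ≟ˢ l′) ×-dec ((m ≟ˢ m′) ×-dec (r ≟ˢ r′)))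

shapesOfDepth : ℕ → List Shape
shapesOfDepth zero = ⊙ ∷ []
shapesOfDepth (suc k) = ⊙ ∷ cartesianProductWith (λ f r → f r) (cartesianProductWith nd qs qs) qs
  where qs = shapesOfDepth k

∈-shapesOfDepth : ∀ k q → sizeˢ q ≤ k → q ∈ shapesOfDepth k
∈-shapesOfDepth zero ⊙ _ = here refl
∈-shapesOfDepth (suc k) ⊙ _ = here refl
∈-shapesOfDepth (suc k) (nd l m r) (s≤s p) = there
  (∈-cartesianProductWith⁺ _ (∈-cartesianProductWith⁺ _
    (∈-shapesOfDepth k l (≤-trans (m≤m+n _ _) p))
    (∈-shapesOfDepth k m (≤-trans (m≤m+n _ _) (≤-trans (m≤n+m _ (sizeˢ l)) p))))
    (∈-shapesOfDepth k r (≤-trans (m≤n+m _ (sizeˢ m)) (≤-trans (m≤n+m _ (sizeˢ l)) p))))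

shapes : ℕ → List Shape
shapes n = filter (λ q → sizeˢ q ℕ.≟ n) (shapesOfDepth n)

∈-shapes⁺ : ∀ {n q} → sizeˢ q ≡ n → q ∈ shapes n
∈-shapes⁺ {n} {q} e = ∈-filter⁺ (λ q → sizeˢ q ℕ.≟ n) (∈-shapesOfDepth n q (≤-reflexive e)) e

∈-shapes⁻ : ∀ {n q} → q ∈ shapes n → sizeˢ q ≡ n
∈-shapes⁻ {n} m = proj₂ (∈-filter⁻ (λ q → sizeˢ q ℕ.≟ n) {xs = shapesOfDepth n} m)

-- The forest of shapes and the induction step

data LeftOnly : Shape → Set where
  leftOnly : ∀ {q} → LeftOnly (nd q ⊙ ⊙)

-- The cube of the first shape is inserted into an edge of the cube of the second one, between
-- trees whose root and whose left (for mid) or middle (for right) child carry the given labels.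
data Link : Shape → Shape × Bool × Bool → Set where
  mid   : ∀ {x y z c d} → Link (nd x (nd y z c) d) (nd (nd x y z) c d , false , true)
  right : ∀ {x z c d} → Link (nd x ⊙ (nd z c d)) (nd x (nd ⊙ z c) d , true , true)

-- Passing to the home shape, `mid` moves nodes from the middle to the left and `right` moves nodes
-- from the right to the middle; the weight 2 makes both lower the rank.
rank : Shape → ℕ
rank ⊙ = 0
rank (nd l m r) = 2 * sizeˢ r + sizeˢ m

link-injective : ∀ {c c′ k} → Link c k → Link c′ k → c ≡ c′
link-injective mid mid = refl
link-injective right right = refl

link-rank : ∀ {c k} → Link c k → rank (proj₁ k) < rank c
link-rank (mid {x} {y} {z} {c} {d}) = ≤-trans (m≤m+n _ _) (≤-reflexive (arith (sizeˢ y) (sizeˢ z) (sizeˢ c) (sizeˢ d)))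
  where
  arith : ∀ (y z c d : ℕ) → suc (2 * d + c) + (y + z) ≡ 2 * d + suc (y + (z + c))
  arith = solve-∀
link-rank (right {x} {z} {c} {d}) = ≤-trans (m≤m+n _ _) (≤-reflexive (arith (sizeˢ z) (sizeˢ c) (sizeˢ d)))
  where
  arith : ∀ (z c d : ℕ) → suc (2 * d + suc (z + c)) + (z + c) ≡ 2 * suc (z + (c + d)) + 0
  arith = solve-∀

link-size : ∀ {c k} → Link c k → sizeˢ (proj₁ k) ≡ sizeˢ c
link-size (mid {x} {y} {z} {c} {d}) = regroup (sizeˢ x) (sizeˢ y) (sizeˢ z) (sizeˢ c) (sizeˢ d)
  where
  open ≡-Reasoning
  regroup : ∀ x y z c d → suc (suc (x + (y + z)) + (c + d)) ≡ suc (x + (suc (y + (z + c)) + d))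
  regroup x y z c d = cong suc (begin
    suc (x + (y + z) + (c + d))   ≡⟨ cong suc (+-assoc x (y + z) (c + d)) ⟩
    suc (x + (y + z + (c + d)))   ≡⟨ cong (λ k → suc (x + k)) (sym (+-assoc (y + z) c d)) ⟩
    suc (x + (y + z + c + d))     ≡⟨ cong (λ k → suc (x + (k + d))) (+-assoc y z c) ⟩
    suc (x + (y + (z + c) + d))   ≡⟨ sym (+-suc x _) ⟩
    x + suc (y + (z + c) + d)     ∎)
link-size (right {x} {z} {c} {d}) = cong (λ k → suc (sizeˢ x + suc k)) (+-assoc (sizeˢ z) (sizeˢ c) (sizeˢ d))

leftOnly-or-link : ∀ n {c} → sizeˢ c ≡ suc n → LeftOnly c ⊎ ∃ (Link c)
leftOnly-or-link n {nd x (nd y z c) d} _ = inj₂ (_ , mid)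
leftOnly-or-link n {nd x ⊙ (nd z c d)} _ = inj₂ (_ , right)
leftOnly-or-link n {nd x ⊙ ⊙} _ = inj₁ leftOnly

-- The two labels place the triangles on both sides of a bichromatic diagonal so that its flip is
-- bichromatic again.
rotate-mid : ∀ {x y z c d} → F (T x y z) c d ~ F x (F y z c) d
rotate-mid = rotation (inj₁ (onˡ here))

rotate-right : ∀ {x y z c d} → T x (T y z c) d ~ T x y (F z c d)
rotate-right = rotation (inj₁ (onʳ here))

-- The class fixes the two labels that the rotation needs, so the ends differ in some other label.
-- The rotation carries this label along, and the images differ in it alone.
transfer : ∀ {c k s t} → Link c k → InClass k s t →
           ∃[ u ] ∃[ v ] (s ~ u × v ~ t × shape u ≡ c × u ≈ v)
transfer {s = F (T x y z) c d} mid (e , f , turnᵇ) = contradiction (cong (proj₁ ∘ proj₂) f) λ ()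
transfer {s = F (T x y z) c d} mid (e , f , inˡ turnᵇ) = contradiction (cong (proj₂ ∘ proj₂) f) λ ()
transfer {s = F (T x y z) c d} mid (refl , f , inˡ (inˡ e)) = _ , _ , rotate-mid , ~-sym rotate-mid , refl , inˡ e
transfer {s = F (T x y z) c d} mid (refl , f , inˡ (inᵐ e)) = _ , _ , rotate-mid , ~-sym rotate-mid , refl , inᵐ (inˡ e)
transfer {s = F (T x y z) c d} mid (refl , f , inˡ (inʳ e)) = _ , _ , rotate-mid , ~-sym rotate-mid , refl , inᵐ (inᵐ e)
transfer {s = F (T x y z) c d} mid (refl , f , inᵐ e) = _ , _ , rotate-mid , ~-sym rotate-mid , refl , inᵐ (inʳ e)
transfer {s = F (T x y z) c d} mid (refl , f , inʳ e) = _ , _ , rotate-mid , ~-sym rotate-mid , refl , inʳ e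
transfer {s = T x (T ∙ z c) d} right (e , f , turnᵇ) = contradiction (cong (proj₁ ∘ proj₂) f) λ ()
transfer {s = T x (T ∙ z c) d} right (e , f , inᵐ turnᵇ) = contradiction (cong (proj₂ ∘ proj₂) f) λ ()
transfer {s = T x (T ∙ z c) d} right (refl , f , inˡ e) = _ , _ , rotate-right , ~-sym rotate-right , refl , inˡ e
transfer {s = T x (T ∙ z c) d} right (refl , f , inᵐ (inᵐ e)) = _ , _ , rotate-right , ~-sym rotate-right , refl , inʳ (inˡ e)
transfer {s = T x (T ∙ z c) d} right (refl , f , inᵐ (inʳ e)) = _ , _ , rotate-right , ~-sym rotate-right , refl , inʳ (inᵐ e)
transfer {s = T x (T ∙ z c) d} right (refl , f , inʳ e) = _ , _ , rotate-right , ~-sym rotate-right , refl , inʳ (inʳ e)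

treeGluing : ∀ n → 3 ≤ n → Gluing treeBlocks
treeGluing n 3≤n = record
  { Valid = λ q → sizeˢ q ≡ suc n
  ; Start = LeftOnly
  ; Link = Link
  ; rank = rank
  ; _≟ₛ_ = _≟ˢ_
  ; link-injective = link-injective
  ; link-rank = link-rank
  ; link-valid = λ v lk → trans (link-size lk) v
  ; link-live = λ { mid _ → s≤s z≤n ; right _ → s≤s z≤n }
  ; start-or-link = leftOnly-or-link n
  ; attach = λ vc lk e →
      let u , v , s~u , v~t , eq , u≈v = transfer lk e
      in u , v , s~u , v~t , treeBlockPath (≤-trans (s≤s 3≤n) (≤-reflexive (sym vc))) eq u≈v
  }

-- The edges are those into which cubes are inserted when passing to size suc n.
record TreeCycle (n : ℕ) : Set where
  field
    {first last} : Tree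
    list     : List Tree
    path     : Path _~_ first last list
    closing  : last ~ first
    unique   : Unique list
    sound    : ∀ {t} → t ∈ list → sizeˢ (shape t) ≡ n
    complete : ∀ {t} → sizeˢ (shape t) ≡ n → t ∈ list
    edges    : ∀ q b → sizeˢ q ≡ n →
               Consec (λ s t → (shape s ≡ q × rootBit s ≡ b) × (shape t ≡ q × rootBit t ≡ b) × s ≈ t) list

unique-reverse : ∀ {A : Set} {xs : List A} → Unique xs → Unique (reverse xs)
unique-reverse {xs = xs} = unique-resp-↭ (↭-sym (↭-reverse xs))

∈-reverse : ∀ {A : Set} {x : A} {xs} → x ∈ xs → x ∈ reverse xs
∈-reverse {xs = xs} = ∈-resp-↭ (↭-sym (↭-reverse xs))

∈-unreverse : ∀ {A : Set} {x : A} {xs} → x ∈ reverse xs → x ∈ xs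
∈-unreverse {xs = xs} = ∈-resp-↭ (↭-reverse xs)

rootBit-slot : ∀ t → rootBit t ≡ proj₁ (slot t)
rootBit-slot ∙ = refl
rootBit-slot (node b l m r) = refl

module _ {n : ℕ} (3≤n : 3 ≤ n) (C : TreeCycle n) where
  private module C = TreeCycle C
  open Gluing (treeGluing n 3≤n) using (State; Extension; extension; ensure-all)

  layer : Bool → Tree → Tree
  layer b t = node b t ∙ ∙

  layer-injective : ∀ b {s t} → layer b s ≡ layer b t → s ≡ t
  layer-injective b refl = refl

  leftOnlyShape : Shape → Shape
  leftOnlyShape q = nd q ⊙ ⊙

  layers : State (layer false C.first) (layer true C.first) (map leftOnlyShape (shapes n))
  layers = record
    { list = list
    ; path = path-++ (path-map (layer false) (~-left false) C.path) (≈⇒~ turnᵇ)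
               (path-map (layer true) (~-left true) (path-reverse ~-sym C.path))
    ; unique = ++⁺ (map⁺ (layer-injective false) C.unique)
                          (map⁺ (layer-injective true) (unique-reverse C.unique))
                          (λ (p , q) → disjoint (∈-map⁻ (layer false) p) (∈-map⁻ (layer true) q))
    ; sound = λ m → sound (∈-++⁻ (map (layer false) C.list) m)
    ; complete = λ m → complete _ (∈-map⁻ leftOnlyShape m)
    ; valid = λ m → valid (∈-map⁻ leftOnlyShape m)
    ; start = λ { v leftOnly → ∈-map⁺ leftOnlyShape (∈-shapes⁺ (trans (sym (+-identityʳ _)) (suc-injective v))) }
    ; edges = λ live m _ → edges live (∈-map⁻ leftOnlyShape m)
    }
    where
    list : List Tree
    list = map (layer false) C.list ++ map (layer true) (reverse C.list)
    disjoint : ∀ {t} → ∃[ x ] (x ∈ C.list × t ≡ layer false x) → ¬ (∃[ y ] (y ∈ reverse C.list × t ≡ layer true y))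
    disjoint (_ , _ , refl) (_ , _ , ())
    sound : ∀ {t} → t ∈ map (layer false) C.list ⊎ t ∈ map (layer true) (reverse C.list) →
            shape t ∈ map leftOnlyShape (shapes n)
    sound (inj₁ m) with ∈-map⁻ (layer false) m
    ... | x , x∈ , refl = ∈-map⁺ leftOnlyShape (∈-shapes⁺ (C.sound x∈))
    sound (inj₂ m) with ∈-map⁻ (layer true) m
    ... | x , x∈ , refl = ∈-map⁺ leftOnlyShape (∈-shapes⁺ (C.sound (∈-unreverse x∈)))
    complete : ∀ t → ∃[ q ] (q ∈ shapes n × shape t ≡ leftOnlyShape q) → t ∈ list
    complete (F x ∙ ∙) (_ , m , refl) = ∈-++⁺ˡ (∈-map⁺ (layer false) (C.complete (∈-shapes⁻ m)))
    complete (T x ∙ ∙) (_ , m , refl) = ∈-++⁺ʳ (map (layer false) C.list) (∈-map⁺ (layer true) (∈-reverse (C.complete (∈-shapes⁻ m))))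
    valid : ∀ {c} → ∃[ q ] (q ∈ shapes n × c ≡ leftOnlyShape q) → sizeˢ c ≡ suc n
    valid (q , m , refl) = cong suc (trans (+-identityʳ _) (∈-shapes⁻ m))
    edges : ∀ {k} → Live k → ∃[ q ] (q ∈ shapes n × proj₁ k ≡ leftOnlyShape q) → Consec (InClass k) list
    -- Under root label `false` the second bit is the root label of the old tree, so the old edge
    -- reserved for `c` serves.
    edges {_ , false , c} live (q , m , refl) = consec-++ˡ (consec-map (layer false)
      (λ { ((refl , refl) , (e , f) , r) → refl , cong₂ (λ p b → nd p ⊙ ⊙ , false , b) e f , inˡ r })
      (C.edges q c (∈-shapes⁻ m)))
    -- Under root label `true` the second bit belongs to the empty middle child, so old edges with
    -- either root label lie in this class; `false` is a choice.
    edges {_ , true , false} live (q , m , refl) = consec-++ʳ (map (layer false) C.list) (consec-map (layer true)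
      (λ { ((refl , _) , (e , _) , r) → refl , cong (λ p → nd p ⊙ ⊙ , true , false) e , inˡ r })
      (consec-reverse (λ (p , q , r) → q , p , ≈-sym r) (C.edges q false (∈-shapes⁻ m))))
    edges {_ , true , true} live (q , m , refl) = contradiction (live refl) λ ()

  extendCycle : TreeCycle (suc n)
  extendCycle with ensure-all (shapes (suc n)) ∈-shapes⁻ layers
  ... | extension st _ new = record
    { list = St.list
    ; path = St.path
    -- Both ends are layers over the same tree `C.first` and differ in the root label.
    ; closing = ≈⇒~ turnᵇ
    ; unique = St.unique
    ; sound = λ m → St.valid (St.sound m)
    ; complete = λ e → St.complete (new (∈-shapes⁺ e))
    -- No link leads to a class with second bit `false`, so its edge has survived all insertions.
    ; edges = λ q b e → consec-weaken
        (λ (p , p′ , r) → unclass p , unclass p′ , r)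
        (St.edges {q , b , false} (λ ()) (new (∈-shapes⁺ e)) (λ _ ()))
    }
    where
    module St = State st
    unclass : ∀ {t q b c} → class t ≡ (q , b , c) → shape t ≡ q × rootBit t ≡ b
    unclass {t} e = cong proj₁ e , trans (rootBit-slot t) (cong (proj₁ ∘ proj₂) e)
    consec-weaken : ∀ {A : Set} {E E′ : A → A → Set} → (∀ {x y} → E x y → E′ x y) → ∀ {xs} → Consec E xs → Consec E′ xs
    consec-weaken f (here e) = here (f e)
    consec-weaken f (there h) = there (consec-weaken f h)

-- The cycle for N = 8

_≟ᵇ_ : DecidableEquality Bin
leaf ≟ᵇ leaf = yes refl
leaf ≟ᵇ bin _ _ = no λ ()
bin _ _ ≟ᵇ leaf = no λ ()
bin l r ≟ᵇ bin l′ r′ = map′ (λ { (refl , refl) → refl }) (λ { refl → refl , refl }) ((l ≟ᵇ l′) ×-dec (r ≟ᵇ r′))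

_≟ᵗ_ : DecidableEquality Tree
∙ ≟ᵗ ∙ = yes refl
∙ ≟ᵗ node _ _ _ _ = no λ ()
node _ _ _ _ ≟ᵗ ∙ = no λ ()
node b l m r ≟ᵗ node b′ l′ m′ r′ =
  map′ (λ { (refl , refl , refl , refl) → refl }) (λ { refl → refl , refl , refl , refl })
       ((b Bool.≟ b′) ×-dec ((l ≟ᵗ l′) ×-dec ((m ≟ᵗ m′) ×-dec (r ≟ᵗ r′))))

-- The searches up to `all-just?` are one-sided: success returns the witness itself, and `nothing`
-- claims nothing. Evaluating them on `trees₃` certifies the base cycle.
rot : ∀ s t → Maybe (Rot s t)
rot (bin l r) (bin l′ r′) = top l r′ <∣> zipWith (λ { refl ρ → onˡ ρ }) (dec⇒maybe (r ≟ᵇ r′)) (rot l l′)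
                                     <∣> zipWith (λ { refl ρ → onʳ ρ }) (dec⇒maybe (l ≟ᵇ l′)) (rot r r′)
  where
  top : ∀ l r′ → Maybe (Rot (bin l r) (bin l′ r′))
  top (bin x y) (bin y′ z) =
    mapᴹ (λ { (refl , refl , refl) → here }) (dec⇒maybe ((x ≟ᵇ l′) ×-dec ((y ≟ᵇ y′) ×-dec (r ≟ᵇ z))))
  top _ _ = nothing
rot _ _ = nothing

adjacent? : ∀ s t → Maybe (s ~ t)
adjacent? s t = mapᴹ (λ ρ → rotation (inj₁ ρ)) (rot (β s) (β t)) <∣> mapᴹ (λ ρ → rotation (inj₂ ρ)) (rot (β t) (β s))

path? : ∀ x z xs → Maybe (Path _~_ x z xs)
path? x z (y ∷ []) = mapᴹ (λ { (refl , refl) → end }) (dec⇒maybe ((x ≟ᵗ y) ×-dec (x ≟ᵗ z)))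
path? x z (x′ ∷ xs@(y ∷ _)) = zipWith (λ { refl (r , p) → r ∷ p }) (dec⇒maybe (x ≟ᵗ x′))
                                (zipWith _,_ (adjacent? x y) (path? y z xs))
path? x z [] = nothing

close? : ∀ s t → Maybe (s ≈ t)
close? (node b l m r) (node b′ l′ m′ r′) =
  mapᴹ (λ { (refl , refl , refl , refl) → turnᵇ })
    (dec⇒maybe ((not b Bool.≟ b′) ×-dec ((l ≟ᵗ l′) ×-dec ((m ≟ᵗ m′) ×-dec (r ≟ᵗ r′)))))
  <∣> zipWith (λ { (refl , refl , refl) e → inˡ e }) (dec⇒maybe ((b Bool.≟ b′) ×-dec ((m ≟ᵗ m′) ×-dec (r ≟ᵗ r′)))) (close? l l′)
  <∣> zipWith (λ { (refl , refl , refl) e → inᵐ e }) (dec⇒maybe ((b Bool.≟ b′) ×-dec ((l ≟ᵗ l′) ×-dec (r ≟ᵗ r′)))) (close? m m′)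
  <∣> zipWith (λ { (refl , refl , refl) e → inʳ e }) (dec⇒maybe ((b Bool.≟ b′) ×-dec ((l ≟ᵗ l′) ×-dec (m ≟ᵗ m′)))) (close? r r′)
close? _ _ = nothing

consec? : ∀ {A : Set} {E : A → A → Set} → (∀ x y → Maybe (E x y)) → ∀ xs → Maybe (Consec E xs)
consec? e? [] = nothing
consec? e? (x ∷ []) = nothing
consec? e? (x ∷ y ∷ zs) = mapᴹ here (e? x y) <∣> mapᴹ there (consec? e? (y ∷ zs))

all-just? : ∀ {A : Set} {P : A → Set} → (∀ x → Maybe (P x)) → ∀ xs → Maybe (All P xs)
all-just? p? [] = just []
all-just? p? (x ∷ xs) = zipWith _∷_ (p? x) (all-just? p? xs)

open import Data.List.Relation.Unary.Unique.DecPropositional _≟ᵗ_ using (unique?)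
open import Data.List.Membership.DecPropositional _≟ᵗ_ using (_∈?_)

bools : List Bool
bools = false ∷ true ∷ []

allVecs : ∀ n → List (Vec Bool n)
allVecs zero = [] ∷ []
allVecs (suc n) = cartesianProductWith _∷_ bools (allVecs n)

∈-allVecs : ∀ {n} (v : Vec Bool n) → v ∈ allVecs n
∈-allVecs [] = here refl
∈-allVecs (false ∷ v) = ∈-cartesianProductWith⁺ _∷_ {xs = bools} (here refl) (∈-allVecs v)
∈-allVecs (true ∷ v) = ∈-cartesianProductWith⁺ _∷_ {xs = bools} (there (here refl)) (∈-allVecs v)


-- Found by computer search; the induction cannot start at size two, where no Hamilton cycle exists.
trees₃ : List Tree
trees₃ =
  T ∙ ∙ (F (F ∙ ∙ ∙) ∙ ∙) ∷ F ∙ ∙ (F (F ∙ ∙ ∙) ∙ ∙) ∷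
  F ∙ ∙ (F (T ∙ ∙ ∙) ∙ ∙) ∷ F ∙ ∙ (T (T ∙ ∙ ∙) ∙ ∙) ∷
  T ∙ ∙ (T (T ∙ ∙ ∙) ∙ ∙) ∷ T ∙ ∙ (T (F ∙ ∙ ∙) ∙ ∙) ∷
  F ∙ ∙ (T (F ∙ ∙ ∙) ∙ ∙) ∷ T (F ∙ ∙ (F ∙ ∙ ∙)) ∙ ∙ ∷
  F (F ∙ ∙ (F ∙ ∙ ∙)) ∙ ∙ ∷ F (F ∙ ∙ (T ∙ ∙ ∙)) ∙ ∙ ∷
  T (F ∙ ∙ (T ∙ ∙ ∙)) ∙ ∙ ∷ T (T ∙ ∙ (T ∙ ∙ ∙)) ∙ ∙ ∷
  T (T ∙ ∙ (F ∙ ∙ ∙)) ∙ ∙ ∷ F (T ∙ ∙ (F ∙ ∙ ∙)) ∙ ∙ ∷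
  F (T ∙ ∙ (T ∙ ∙ ∙)) ∙ ∙ ∷ F ∙ (F ∙ (T ∙ ∙ ∙) ∙) ∙ ∷
  T ∙ (F ∙ (T ∙ ∙ ∙) ∙) ∙ ∷ T ∙ (F ∙ (F ∙ ∙ ∙) ∙) ∙ ∷
  F ∙ (F ∙ (F ∙ ∙ ∙) ∙) ∙ ∷ F ∙ (T ∙ (F ∙ ∙ ∙) ∙) ∙ ∷
  T ∙ (T ∙ (F ∙ ∙ ∙) ∙) ∙ ∷ T ∙ (T ∙ (T ∙ ∙ ∙) ∙) ∙ ∷
  F ∙ (T ∙ (T ∙ ∙ ∙) ∙) ∙ ∷ F ∙ (T ∙ ∙ (F ∙ ∙ ∙)) ∙ ∷
  F ∙ (T ∙ ∙ (T ∙ ∙ ∙)) ∙ ∷ T ∙ (T ∙ ∙ (T ∙ ∙ ∙)) ∙ ∷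
  T ∙ (T ∙ ∙ (F ∙ ∙ ∙)) ∙ ∷ T ∙ (F ∙ ∙ (F ∙ ∙ ∙)) ∙ ∷
  T ∙ (F ∙ ∙ (T ∙ ∙ ∙)) ∙ ∷ F ∙ (F ∙ ∙ (T ∙ ∙ ∙)) ∙ ∷
  F ∙ (F ∙ ∙ (F ∙ ∙ ∙)) ∙ ∷ F (T ∙ ∙ ∙) (F ∙ ∙ ∙) ∙ ∷
  T (T ∙ ∙ ∙) (F ∙ ∙ ∙) ∙ ∷ T (F ∙ ∙ ∙) (F ∙ ∙ ∙) ∙ ∷
  F (F ∙ ∙ ∙) (F ∙ ∙ ∙) ∙ ∷ F (F ∙ ∙ ∙) (T ∙ ∙ ∙) ∙ ∷
  F (T ∙ ∙ ∙) (T ∙ ∙ ∙) ∙ ∷ T (T ∙ ∙ ∙) (T ∙ ∙ ∙) ∙ ∷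
  T (F ∙ ∙ ∙) (T ∙ ∙ ∙) ∙ ∷ T (F ∙ ∙ ∙) ∙ (F ∙ ∙ ∙) ∷
  F (F ∙ ∙ ∙) ∙ (F ∙ ∙ ∙) ∷ F (F ∙ ∙ ∙) ∙ (T ∙ ∙ ∙) ∷
  T (F ∙ ∙ ∙) ∙ (T ∙ ∙ ∙) ∷ T (T ∙ ∙ ∙) ∙ (T ∙ ∙ ∙) ∷
  T (T ∙ ∙ ∙) ∙ (F ∙ ∙ ∙) ∷ F (T ∙ ∙ ∙) ∙ (F ∙ ∙ ∙) ∷
  F (T ∙ ∙ ∙) ∙ (T ∙ ∙ ∙) ∷ T (F (T ∙ ∙ ∙) ∙ ∙) ∙ ∙ ∷
  T (T (T ∙ ∙ ∙) ∙ ∙) ∙ ∙ ∷ F (T (T ∙ ∙ ∙) ∙ ∙) ∙ ∙ ∷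
  F (T (F ∙ ∙ ∙) ∙ ∙) ∙ ∙ ∷ T (T (F ∙ ∙ ∙) ∙ ∙) ∙ ∙ ∷
  T (F (F ∙ ∙ ∙) ∙ ∙) ∙ ∙ ∷ F (F (F ∙ ∙ ∙) ∙ ∙) ∙ ∙ ∷
  F (F (T ∙ ∙ ∙) ∙ ∙) ∙ ∙ ∷ F (F ∙ (F ∙ ∙ ∙) ∙) ∙ ∙ ∷
  F (F ∙ (T ∙ ∙ ∙) ∙) ∙ ∙ ∷ T (F ∙ (T ∙ ∙ ∙) ∙) ∙ ∙ ∷
  T (F ∙ (F ∙ ∙ ∙) ∙) ∙ ∙ ∷ T (T ∙ (F ∙ ∙ ∙) ∙) ∙ ∙ ∷
  T (T ∙ (T ∙ ∙ ∙) ∙) ∙ ∙ ∷ F (T ∙ (T ∙ ∙ ∙) ∙) ∙ ∙ ∷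
  F (T ∙ (F ∙ ∙ ∙) ∙) ∙ ∙ ∷ F ∙ (F (F ∙ ∙ ∙) ∙ ∙) ∙ ∷
  F ∙ (F (T ∙ ∙ ∙) ∙ ∙) ∙ ∷ T ∙ (F (T ∙ ∙ ∙) ∙ ∙) ∙ ∷
  T ∙ (F (F ∙ ∙ ∙) ∙ ∙) ∙ ∷ T ∙ (T (F ∙ ∙ ∙) ∙ ∙) ∙ ∷
  F ∙ (T (F ∙ ∙ ∙) ∙ ∙) ∙ ∷ F ∙ (T (T ∙ ∙ ∙) ∙ ∙) ∙ ∷
  T ∙ (T (T ∙ ∙ ∙) ∙ ∙) ∙ ∷ T ∙ (T ∙ ∙ ∙) (F ∙ ∙ ∙) ∷
  T ∙ (F ∙ ∙ ∙) (F ∙ ∙ ∙) ∷ T ∙ (F ∙ ∙ ∙) (T ∙ ∙ ∙) ∷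
  F ∙ (F ∙ ∙ ∙) (T ∙ ∙ ∙) ∷ F ∙ (F ∙ ∙ ∙) (F ∙ ∙ ∙) ∷
  F ∙ (T ∙ ∙ ∙) (F ∙ ∙ ∙) ∷ F ∙ (T ∙ ∙ ∙) (T ∙ ∙ ∙) ∷
  T ∙ (T ∙ ∙ ∙) (T ∙ ∙ ∙) ∷ T ∙ ∙ (F ∙ ∙ (T ∙ ∙ ∙)) ∷
  T ∙ ∙ (F ∙ ∙ (F ∙ ∙ ∙)) ∷ F ∙ ∙ (F ∙ ∙ (F ∙ ∙ ∙)) ∷
  F ∙ ∙ (F ∙ ∙ (T ∙ ∙ ∙)) ∷ F ∙ ∙ (T ∙ ∙ (T ∙ ∙ ∙)) ∷
  T ∙ ∙ (T ∙ ∙ (T ∙ ∙ ∙)) ∷ T ∙ ∙ (T ∙ ∙ (F ∙ ∙ ∙)) ∷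
  F ∙ ∙ (T ∙ ∙ (F ∙ ∙ ∙)) ∷ F ∙ ∙ (T ∙ (T ∙ ∙ ∙) ∙) ∷
  T ∙ ∙ (T ∙ (T ∙ ∙ ∙) ∙) ∷ T ∙ ∙ (F ∙ (T ∙ ∙ ∙) ∙) ∷
  F ∙ ∙ (F ∙ (T ∙ ∙ ∙) ∙) ∷ F ∙ ∙ (F ∙ (F ∙ ∙ ∙) ∙) ∷
  F ∙ ∙ (T ∙ (F ∙ ∙ ∙) ∙) ∷ T ∙ ∙ (T ∙ (F ∙ ∙ ∙) ∙) ∷
  T ∙ ∙ (F ∙ (F ∙ ∙ ∙) ∙) ∷ T ∙ ∙ (F (T ∙ ∙ ∙) ∙ ∙) ∷ []

Reserved : Shape → Bool → Tree → Tree → Set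
Reserved q b s t = (shape s ≡ q × rootBit s ≡ b) × (shape t ≡ q × rootBit t ≡ b) × s ≈ t

reserved? : ∀ q b s t → Maybe (Reserved q b s t)
reserved? q b s t = zipWith (λ (e , f) r → e , f , r)
  (dec⇒maybe (((shape s ≟ˢ q) ×-dec (rootBit s Bool.≟ b)) ×-dec ((shape t ≟ˢ q) ×-dec (rootBit t Bool.≟ b)))) (close? s t)

all-reserved : All (λ q → All (λ b → Consec (Reserved q b) trees₃) bools) (shapes 3)
all-reserved = from-just (all-just? (λ q → all-just? (λ b → consec? (reserved? q b) trees₃) bools) (shapes 3))

all-listed : All (λ q → All (λ v → fill q v ∈ trees₃) (allVecs (sizeˢ q))) (shapes 3)
all-listed = from-yes (all? (λ q → all? (λ v → fill q v ∈? trees₃) (allVecs (sizeˢ q))) (shapes 3))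

treeCycle₃ : TreeCycle 3
treeCycle₃ = record
  { list = trees₃
  ; path = from-just (path? (T ∙ ∙ (F (F ∙ ∙ ∙) ∙ ∙)) (T ∙ ∙ (F (T ∙ ∙ ∙) ∙ ∙)) trees₃)
  ; closing = from-just (adjacent? (T ∙ ∙ (F (T ∙ ∙ ∙) ∙ ∙)) (T ∙ ∙ (F (F ∙ ∙ ∙) ∙ ∙)))
  ; unique = from-yes (unique? trees₃)
  ; sound = All.lookup (from-yes (all? (λ t → sizeˢ (shape t) ℕ.≟ 3) trees₃))
  ; complete = λ {t} e → subst (_∈ trees₃) (fill-labels t)
      (All.lookup (All.lookup all-listed (∈-shapes⁺ e)) (∈-allVecs (labels (shape t) t)))
  ; edges = λ q b e → All.lookup (All.lookup all-reserved (∈-shapes⁺ e)) (bool b)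
  }
  where
  bool : ∀ b → b ∈ bools
  bool false = here refl
  bool true = there (here refl)

-- The odd case

-- For odd N the side joining the first and the last point is monochromatic; below it lies a
-- triangle whose two other sides carry a pair of ternary trees.
Pair : Set
Pair = Tree × Tree

βᵖ : Pair → Bin
βᵖ (s , t) = bin (β s) (β t)

data _~ᵖ_ : Pair → Pair → Set where
  rotation : ∀ {p q} → βᵖ p ⇄ βᵖ q → p ~ᵖ q

data _≈ᵖ_ : Pair → Pair → Set where
  inˡ : ∀ {s s′ t} → s ≈ s′ → (s , t) ≈ᵖ (s′ , t)
  inʳ : ∀ {s t t′} → t ≈ t′ → (s , t) ≈ᵖ (s , t′)

~ᵖ-sym : ∀ {p q} → p ~ᵖ q → q ~ᵖ p
~ᵖ-sym (rotation ρ) = rotation (⇄-sym ρ)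

≈ᵖ⇒~ᵖ : ∀ {p q} → p ≈ᵖ q → p ~ᵖ q
≈ᵖ⇒~ᵖ (inˡ e) = rotation (⇄-onˡ (≈⇒⇄ e))
≈ᵖ⇒~ᵖ (inʳ e) = rotation (⇄-onʳ (≈⇒⇄ e))

PairShape : Set
PairShape = Shape × Shape

sizeᵖ : PairShape → ℕ
sizeᵖ (l , r) = sizeˢ l + sizeˢ r

shapeᵖ : Pair → PairShape
shapeᵖ (s , t) = shape s , shape t

-- One reserved class per shape suffices: there is only one kind of link, and the cycle of pairs is
-- not extended to a larger size.
pairBlocks : Blocks
pairBlocks = record
  { A = Pair ; S = PairShape ; K = PairShape × Bool
  ; _~_ = _~ᵖ_ ; _≈_ = _≈ᵖ_
  ; block = shapeᵖ
  ; class = λ p → shapeᵖ p , rootBit (proj₁ p)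
  ; home = proj₁
  ; Live = λ ((l , _) , b) → 0 < sizeˢ l × b ≡ true
  }

open Blocks pairBlocks using () renaming (Live to Liveᵖ; InClass to InClassᵖ; BlockPath to BlockPathᵖ; class to classᵖ)

fillᵖ : ∀ q → Vec Bool (sizeᵖ q) → Pair
fillᵖ (l , r) v = fill l (take (sizeˢ l) v) , fill r (drop (sizeˢ l) v)

labelsᵖ : ∀ q → Pair → Vec Bool (sizeᵖ q)
labelsᵖ (l , r) (s , t) = labels l s ++ᵛ labels r t

labels-fillᵖ : ∀ q v → labelsᵖ q (fillᵖ q v) ≡ v
labels-fillᵖ (l , r) v = trans (cong₂ _++ᵛ_ (labels-fill l _) (labels-fill r _)) (take++drop≡id (sizeˢ l) v)

fill-ontoᵖ : ∀ q {p} → shapeᵖ p ≡ q → p ≡ fillᵖ q (labelsᵖ q p)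
fill-ontoᵖ q {s , t} refl
  rewrite take-++ (labels (shape s) s) (labels (shape t) t) | drop-++ (labels (shape s) s) (labels (shape t) t)
        | fill-labels s | fill-labels t = refl

fill-≈ᵖ : ∀ q {u v} → Neighbour u v → fillᵖ q u ≈ᵖ fillᵖ q v
fill-≈ᵖ (l , r) e with neighbour-split (sizeˢ l) e
... | inj₁ (e′ , eq) rewrite eq = inˡ (fill-≈ l e′)
... | inj₂ (eq , e′) rewrite eq = inʳ (fill-≈ r e′)

labels-≈ᵖ : ∀ {p q} → p ≈ᵖ q → Neighbour (labelsᵖ (shapeᵖ p) p) (labelsᵖ (shapeᵖ p) q)
labels-≈ᵖ (inˡ e) = neighbour-++ˡ _ (labels-≈ e)
labels-≈ᵖ (inʳ {s} e) = neighbour-++ʳ (labels (shape s) s) (labels-≈ e)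

shape-≈ᵖ : ∀ {p q} → p ≈ᵖ q → shapeᵖ p ≡ shapeᵖ q
shape-≈ᵖ (inˡ e) = cong (_, _) (shape-≈ e)
shape-≈ᵖ (inʳ e) = cong (_ ,_) (shape-≈ e)

shape-fillᵖ : ∀ q v → shapeᵖ (fillᵖ q v) ≡ q
shape-fillᵖ (l , r) v = cong₂ _,_ (shape-fill l _) (shape-fill r _)

pairBlock : ∀ q → 3 ≤ sizeᵖ q → CubeBlock pairBlocks q (fillᵖ q)
pairBlock q@(l , r) 3≤ = record
  { 2≤n = ≤-trans (s≤s (s≤s z≤n)) 3≤
  ; injective = λ {u} {v} e → trans (sym (labels-fillᵖ q u)) (trans (cong (labelsᵖ q) e) (labels-fillᵖ q v))
  ; code-block = shape-fillᵖ q
  ; onto = λ {p} e → labelsᵖ q p , fill-ontoᵖ q e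
  ; adjacent = ≈ᵖ⇒~ᵖ ∘ fill-≈ᵖ q
  ; close = fill-≈ᵖ q
  -- Position 0 holds the root label of the left tree, 1 is the direction, and at 2 the edge is kept
  -- away from `u`; hence three nodes are enough.
  ; direction = fromℕ< 1<
  ; spread = spread
  }
  where
  0< : 0 < sizeᵖ q
  0< = ≤-trans (s≤s z≤n) 3≤
  1< : 1 < sizeᵖ q
  1< = ≤-trans (s≤s (s≤s z≤n)) 3≤
  spread : ∀ u {k} → Liveᵖ k → proj₁ k ≡ q →
           ∃[ x ] (x ≢ u × x ≢ flip (fromℕ< 1<) u × classᵖ (fillᵖ q x) ≡ k × classᵖ (fillᵖ q (flip (fromℕ< 1<) x)) ≡ k)
  spread u (0<l , refl) refl
    with away-from₁ (fromℕ<-≢ 0< 3≤ λ ()) (fromℕ<-≢ 0< 1< λ ()) (fromℕ<-≢ 3≤ 1< λ ()) u true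
  ... | x , x≢ , x≢′ , e , e′ = x , x≢ , x≢′ , classified x e , classified _ e′
    where
    classified : ∀ x → lookup x (fromℕ< 0<) ≡ true → classᵖ (fillᵖ q x) ≡ (q , true)
    classified x e = cong₂ _,_ (shape-fillᵖ q x) (trans (rootBit-fill-take l (fromℕ< 0<) 0<l (toℕ-fromℕ< 0<)) e)

pairBlockPath : ∀ {q u v} → 3 ≤ sizeᵖ q → shapeᵖ u ≡ q → u ≈ᵖ v → BlockPathᵖ q u v
pairBlockPath {q} {u} {v} 3≤ refl e = subst₂ (BlockPathᵖ q) (sym (fill-ontoᵖ q refl)) v≡
  (CubeBlock.blockPath (pairBlock q 3≤) i (labelsᵖ q u))
  where
  flip-of : ∀ {w} → Neighbour (labelsᵖ q u) w → ∃[ i ] w ≡ flip i (labelsᵖ q u)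
  flip-of (flipped i) = i , refl
  i = proj₁ (flip-of (labels-≈ᵖ e))
  v≡ : fillᵖ q (flip i (labelsᵖ q u)) ≡ v
  v≡ = trans (cong (fillᵖ q) (sym (proj₂ (flip-of (labels-≈ᵖ e))))) (sym (fill-ontoᵖ q (sym (shape-≈ᵖ e))))

-- The rotation behind this link acts at the root of the binary tree: it moves the apex of the
-- triangle on the monochromatic side, and nodes pass from one tree to the other.
data Linkᵖ : PairShape → PairShape × Bool → Set where
  across : ∀ {x y z c} → Linkᵖ (x , nd y z c) ((nd x y z , c) , true)

data RightEmpty : PairShape → Set where
  rightEmpty : ∀ {q} → RightEmpty (q , ⊙)

rotate-across : ∀ {x y z c} → (T x y z , c) ~ᵖ (x , F y z c)
rotate-across = rotation (inj₁ here)

transferᵖ : ∀ {c k p q} → Linkᵖ c k → InClassᵖ k p q →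
            ∃[ u ] ∃[ v ] (p ~ᵖ u × v ~ᵖ q × shapeᵖ u ≡ c × u ≈ᵖ v)
transferᵖ {p = T x y z , c} across (e , f , inˡ turnᵇ) = contradiction (cong proj₂ f) λ ()
transferᵖ {p = T x y z , c} across (refl , f , inˡ (inˡ e)) = _ , _ , rotate-across , ~ᵖ-sym rotate-across , refl , inˡ e
transferᵖ {p = T x y z , c} across (refl , f , inˡ (inᵐ e)) = _ , _ , rotate-across , ~ᵖ-sym rotate-across , refl , inʳ (inˡ e)
transferᵖ {p = T x y z , c} across (refl , f , inˡ (inʳ e)) = _ , _ , rotate-across , ~ᵖ-sym rotate-across , refl , inʳ (inᵐ e)
transferᵖ {p = T x y z , c} across (refl , f , inʳ e) = _ , _ , rotate-across , ~ᵖ-sym rotate-across , refl , inʳ (inʳ e)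

linkᵖ-size : ∀ {c k} → Linkᵖ c k → sizeᵖ (proj₁ k) ≡ sizeᵖ c
linkᵖ-size (across {x} {y} {z} {c}) = arith (sizeˢ x) (sizeˢ y) (sizeˢ z) (sizeˢ c)
  where
  arith : ∀ (x y z c : ℕ) → suc (x + (y + z)) + c ≡ x + suc (y + (z + c))
  arith = solve-∀

rightEmpty-or-link : ∀ c → RightEmpty c ⊎ ∃ (Linkᵖ c)
rightEmpty-or-link (x , ⊙) = inj₁ rightEmpty
rightEmpty-or-link (x , nd y z c) = inj₂ (_ , across)

pairGluing : ∀ n → 3 ≤ n → Gluing pairBlocks
pairGluing n 3≤n = record
  { Valid = λ q → sizeᵖ q ≡ n
  ; Start = RightEmpty
  ; Link = Linkᵖ
  ; rank = sizeˢ ∘ proj₂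
  ; _≟ₛ_ = ≡-dec _≟ˢ_ _≟ˢ_
  ; link-injective = λ { across across → refl }
  ; link-rank = λ { (across {y = y} {z}) → s≤s (≤-trans (m≤n+m _ (sizeˢ z)) (m≤n+m _ (sizeˢ y))) }
  ; link-valid = λ v lk → trans (linkᵖ-size lk) v
  ; link-live = λ { across → s≤s z≤n , refl }
  ; start-or-link = λ {c} _ → rightEmpty-or-link c
  ; attach = λ vc lk e →
      let u , v , p~u , v~q , eq , u≈v = transferᵖ lk e
      in u , v , p~u , v~q , pairBlockPath (≤-trans 3≤n (≤-reflexive (sym vc))) eq u≈v
  }

pairShapes : ℕ → List PairShape
pairShapes n = filter (λ q → sizeᵖ q ℕ.≟ n) (cartesianProduct (shapesOfDepth n) (shapesOfDepth n))

∈-pairShapes⁺ : ∀ {n q} → sizeᵖ q ≡ n → q ∈ pairShapes n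
∈-pairShapes⁺ {n} {l , r} refl = ∈-filter⁺ (λ q → sizeᵖ q ℕ.≟ n)
  (∈-cartesianProduct⁺ (∈-shapesOfDepth n l (m≤m+n _ _)) (∈-shapesOfDepth n r (m≤n+m _ _))) refl

∈-pairShapes⁻ : ∀ {n q} → q ∈ pairShapes n → sizeᵖ q ≡ n
∈-pairShapes⁻ {n} m = proj₂ (∈-filter⁻ (λ q → sizeᵖ q ℕ.≟ n) {xs = cartesianProduct (shapesOfDepth n) (shapesOfDepth n)} m)

record PairCycle (n : ℕ) : Set where
  field
    {first last} : Pair
    list     : List Pair
    path     : Path _~ᵖ_ first last list
    closing  : last ~ᵖ first
    unique   : Unique list
    sound    : ∀ {p} → p ∈ list → sizeᵖ (shapeᵖ p) ≡ n
    complete : ∀ {p} → sizeᵖ (shapeᵖ p) ≡ n → p ∈ list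

~-pair : ∀ {s t} → s ~ t → (s , ∙) ~ᵖ (t , ∙)
~-pair (rotation ρ) = rotation (⇄-onˡ ρ)

pairCycle : ∀ {n} → 3 ≤ n → TreeCycle n → PairCycle n
pairCycle {n} 3≤n C = cycle (ensure-all (pairShapes n) ∈-pairShapes⁻ start)
  where
  module C = TreeCycle C
  open Gluing (pairGluing n 3≤n) using (State; Extension; extension; ensure-all)
  embed : Tree → Pair
  embed t = t , ∙
  embedˢ : Shape → PairShape
  embedˢ q = q , ⊙
  complete : ∀ p → ∃[ q ] (q ∈ shapes n × shapeᵖ p ≡ embedˢ q) → p ∈ map embed C.list
  complete (t , ∙) (_ , m , refl) = ∈-map⁺ embed (C.complete (∈-shapes⁻ m))
  sound : ∀ {p} → ∃[ t ] (t ∈ C.list × p ≡ embed t) → shapeᵖ p ∈ map embedˢ (shapes n)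
  sound (t , m , refl) = ∈-map⁺ embedˢ (∈-shapes⁺ (C.sound m))
  valid : ∀ {c} → ∃[ q ] (q ∈ shapes n × c ≡ embedˢ q) → sizeᵖ c ≡ n
  valid (q , m , refl) = trans (+-identityʳ _) (∈-shapes⁻ m)
  edges : ∀ {k} → Liveᵖ k → ∃[ q ] (q ∈ shapes n × proj₁ k ≡ embedˢ q) → Consec (InClassᵖ k) (map embed C.list)
  edges (_ , refl) (q , m , refl) = consec-map embed
    (λ { ((e , f) , (e′ , f′) , r) → cong₂ (λ s b → (s , ⊙) , b) e f , cong₂ (λ s b → (s , ⊙) , b) e′ f′ , inˡ r })
    (C.edges q true (∈-shapes⁻ m))
  start : State (embed C.first) (embed C.last) (map embedˢ (shapes n))
  start = record
    { list = map embed C.list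
    ; path = path-map embed ~-pair C.path
    ; unique = map⁺ (cong proj₁) C.unique
    ; sound = λ m → sound (∈-map⁻ embed m)
    ; complete = λ {p} m → complete p (∈-map⁻ embedˢ m)
    ; valid = λ m → valid (∈-map⁻ embedˢ m)
    ; start = λ { v rightEmpty → ∈-map⁺ embedˢ (∈-shapes⁺ (trans (sym (+-identityʳ _)) v)) }
    ; edges = λ live m _ → edges live (∈-map⁻ embedˢ m)
    }
  cycle : Extension (embed C.first) (embed C.last) (map embedˢ (shapes n)) (pairShapes n) → PairCycle n
  cycle (extension st _ new) = record
    { list = St.list
    ; path = St.path
    ; closing = ~-pair C.closing
    ; unique = St.unique
    ; sound = λ m → St.valid (St.sound m)
    ; complete = λ e → St.complete (new (∈-pairShapes⁺ e))
    }
    where module St = State st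

-- Hamilton cycles in the graph of colorful triangulations

treeCycle : ∀ k → TreeCycle (3 + k)
treeCycle zero = treeCycle₃
treeCycle (suc k) = extendCycle (s≤s (s≤s (s≤s z≤n))) (treeCycle k)

path-linked : ∀ {A : Set} {R : A → A → Set} {x y z xs} → Path R x y xs → R y z → Linked R (xs ++ z ∷ [])
path-linked end r = r ∷ [-]
path-linked (s ∷ p@end) r = s ∷ path-linked p r
path-linked (s ∷ p@(_ ∷ _)) r = s ∷ path-linked p r

path-head : ∀ {A : Set} {R : A → A → Set} {x y xs} → Path R x y xs → ∃[ ys ] xs ≡ x ∷ ys
path-head end = _ , refl
path-head (_ ∷ _) = _ , refl

path-map-∈ : ∀ {A B : Set} {R : A → A → Set} {S : B → B → Set} (f : A → B) {x y xs} →
             (∀ {a b} → a ∈ xs → b ∈ xs → R a b → S (f a) (f b)) → Path R x y xs → Path S (f x) (f y) (map f xs)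
path-map-∈ f g end = end
path-map-∈ f g (r ∷ p) with path-head p
... | _ , refl = g (here refl) (there (here refl)) r ∷ path-map-∈ f (λ m m′ → g (there m) (there m′)) p

path-last : ∀ {A : Set} {R : A → A → Set} {x y xs} → Path R x y xs → y ∈ xs
path-last end = here refl
path-last (_ ∷ p) = there (path-last p)

three-distinct : ∀ {A : Set} {xs : List A} {a b c} → a ∈ xs → b ∈ xs → c ∈ xs → a ≢ b → a ≢ c → b ≢ c → 3 ≤ length xs
three-distinct {xs = _ ∷ _ ∷ _ ∷ _} _ _ _ _ _ _ = s≤s (s≤s (s≤s z≤n))
three-distinct (here refl) (here refl) _ a≢b _ _ = contradiction refl a≢b
three-distinct (here refl) _ (here refl) _ a≢c _ = contradiction refl a≢c
three-distinct _ (here refl) (here refl) _ _ b≢c = contradiction refl b≢c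
three-distinct (there (here refl)) (there (here refl)) _ a≢b _ _ = contradiction refl a≢b
three-distinct (there (here refl)) _ (there (here refl)) _ a≢c _ = contradiction refl a≢c
three-distinct _ (there (here refl)) (there (here refl)) _ _ b≢c = contradiction refl b≢c

-- Injectivity and adjacency are asked only for members of the list, because `enc` is known to be
-- faithful only on trees whose size fits `N`.
hamiltonCycle : ∀ {A B : Set} {R : A → A → Set} {V : B → Set} {Adj : B → B → Set} (code : A → B) {x y xs} →
  Path R x y xs → R y x → Unique xs → 3 ≤ length xs →
  (∀ {a b} → a ∈ xs → b ∈ xs → code a ≡ code b → a ≡ b) →
  (∀ {a b} → a ∈ xs → b ∈ xs → R a b → Adj (code a) (code b)) →
  (∀ {a} → a ∈ xs → V (code a)) →
  (∀ {v} → V v → ∃[ a ] (a ∈ xs × v ≡ code a)) →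
  HamiltonCycle V Adj
hamiltonCycle {V = V} code {x} p r u len inj adj sound onto with path-head p
... | ys , refl = code x , map code ys ,
  subst (3 ≤_) (sym (length-map code (x ∷ ys))) len ,
  unique-map u inj ,
  All.tabulate (λ m → let a , m′ , eq = ∈-map⁻ code m in subst V (sym eq) (sound m′)) ,
  (λ v Vv → let a , m , eq = onto Vv in subst (_∈ map code (x ∷ ys)) (sym eq) (∈-map⁺ code m)) ,
  path-linked (path-map-∈ code adj p) (adj (path-last p) (here refl) r)
  where
  unique-map : ∀ {xs} → Unique xs → (∀ {a b} → a ∈ xs → b ∈ xs → code a ≡ code b → a ≡ b) → Unique (map code xs)
  unique-map AllPairs.[] inj = AllPairs.[]
  unique-map {z ∷ zs} (z∉ AllPairs.∷ u) inj =
    ∉⇒All≢ _ (λ m → let a , m′ , eq = ∈-map⁻ code m in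
                All≢⇒∉ z∉ (subst (_∈ zs) (sym (inj (here refl) (there m′) eq)) m′))
    AllPairs.∷ unique-map u (λ m m′ → inj (there m) (there m′))

-- A source of trees of any given size, from which three distinct members of the cycle are made to
-- bound its length below.
comb : ℕ → Tree
comb zero = ∙
comb (suc n) = F ∙ ∙ (comb n)

size-comb : ∀ n → sizeˢ (shape (comb n)) ≡ n
size-comb zero = refl
size-comb (suc n) = cong suc (size-comb n)

sizeˢ-witness : ∀ k b → sizeˢ (shape (node b ∙ ∙ (comb (2 + k)))) ≡ 3 + k
sizeˢ-witness k b = cong suc (size-comb (2 + k))

sizeˢ-witness′ : ∀ k → sizeˢ (shape (F ∙ (comb (2 + k)) ∙)) ≡ 3 + k
sizeˢ-witness′ k = cong suc (trans (+-identityʳ _) (size-comb (2 + k)))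

even-hamilton : ∀ k → F-HasHamiltonCycle (2 + 2 * (3 + k))
even-hamilton k = hamiltonCycle (λ t → enc _ (β t)) C.path C.closing C.unique long
  (λ m m′ e → β-injective _ _ (enc-injective (spans-tree m) (spans-tree m′) e))
  (λ { m m′ (rotation ρ) → ⇄-enc (spans-tree m) (spans-tree m′) ρ })
  (λ {t} m → enc-node (spans-tree m) (NoMono-β t 0))
  (λ isN → let t , e , eq = even-node {3 + k} isN in t , C.complete (trans (size-shape t) e) , eq)
  where
  module C = TreeCycle (treeCycle k)
  spans-tree : ∀ {t} → t ∈ C.list → Spans (2 + 2 * (3 + k)) (β t)
  spans-tree {t} m = spans-β _ t (trans (sym (size-shape t)) (C.sound m))
  long : 3 ≤ length C.list
  long = three-distinct {a = F ∙ ∙ (comb (2 + k))} {T ∙ ∙ (comb (2 + k))} {F ∙ (comb (2 + k)) ∙}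
           (C.complete (sizeˢ-witness k false)) (C.complete (sizeˢ-witness k true)) (C.complete (sizeˢ-witness′ k))
           (λ ()) (λ ()) (λ ())

odd-hamilton : ∀ k → F-HasHamiltonCycle (3 + 2 * (3 + k))
odd-hamilton k = hamiltonCycle (λ p → enc _ (βᵖ p)) C.path C.closing C.unique long
  (λ m m′ e → pair-injective (enc-injective (spans-tree m) (spans-tree m′) e))
  (λ { m m′ (rotation ρ) → ⇄-enc (spans-tree m) (spans-tree m′) ρ })
  (λ {p} m → enc-node (spans-tree m) (NoMono-bin 0 (proj₁ p) (proj₂ p) (NoMono-β (proj₁ p) _) (NoMono-β (proj₂ p) _)))
  (λ isN → let s , t , e , eq = odd-node {3 + k} isN in (s , t) , C.complete (trans (cong₂ _+_ (size-shape s) (size-shape t)) e) , eq)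
  where
  module C = PairCycle (pairCycle (s≤s (s≤s (s≤s z≤n))) (treeCycle k))
  pair-injective : ∀ {p q} → βᵖ p ≡ βᵖ q → p ≡ q
  pair-injective e = cong₂ _,_ (β-injective _ _ (proj₁ (bin-injective e))) (β-injective _ _ (proj₂ (bin-injective e)))
  spans-tree : ∀ {p} → p ∈ C.list → Spans (3 + 2 * (3 + k)) (βᵖ p)
  spans-tree {s , t} m = spans-pair _ s t (trans (sym (cong₂ _+_ (size-shape s) (size-shape t))) (C.sound m))
  long : 3 ≤ length C.list
  long = three-distinct {a = F ∙ ∙ (comb (2 + k)) , ∙} {T ∙ ∙ (comb (2 + k)) , ∙} {F ∙ (comb (2 + k)) ∙ , ∙}
           (C.complete (with-∙ (F ∙ ∙ (comb (2 + k))) (sizeˢ-witness k false)))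
           (C.complete (with-∙ (T ∙ ∙ (comb (2 + k))) (sizeˢ-witness k true)))
           (C.complete (with-∙ (F ∙ (comb (2 + k)) ∙) (sizeˢ-witness′ k))) (λ ()) (λ ()) (λ ())
    where
    with-∙ : ∀ t → sizeˢ (shape t) ≡ 3 + k → sizeᵖ (shapeᵖ (t , ∙)) ≡ 3 + k
    with-∙ t e = trans (+-identityʳ _) e

half : ∀ n → (∃[ k ] n ≡ 2 * k) ⊎ (∃[ k ] n ≡ suc (2 * k))
half zero = inj₁ (0 , refl)
half (suc n) with half n
... | inj₁ (k , refl) = inj₂ (k , refl)
... | inj₂ (k , refl) = inj₁ (suc k , cong suc (sym (+-suc k (k + 0))))

theorem1 : (N : ℕ) → 8 ≤ N → F-HasHamiltonCycle N
theorem1 N 8≤N with half (N ∸ 8)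
... | inj₁ (k , eq) = subst F-HasHamiltonCycle (trans (even k) (trans (cong (8 +_) (sym eq)) (m+[n∸m]≡n 8≤N))) (even-hamilton k)
  where
  even : ∀ (k : ℕ) → 2 + 2 * (3 + k) ≡ 8 + 2 * k
  even = solve-∀
... | inj₂ (k , eq) = subst F-HasHamiltonCycle (trans (odd k) (trans (cong (8 +_) (sym eq)) (m+[n∸m]≡n 8≤N))) (odd-hamilton k)
  where
  odd : ∀ (k : ℕ) → 3 + 2 * (3 + k) ≡ 8 + suc (2 * k)
  odd = solve-∀
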